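{- Let $G$ be a connected graph, let $x,y$ be two distinct vertices of $G$, let $n\ge 3$, and let $F_n(G)=F_n(G,x,y)$ be the generalized flower graph with petals $G_1,\dots,G_n$ (cyclically arranged copies of $G$, the vertex $y$ of $G_i$ being identified with the vertex $x$ of $G_{i+1}$, indices mod $n$). Let $u,v$ be vertices of $F_n(G)$. (i) Suppose $u$ and $v$ are in different copies of $G$. Label the copies cyclically such that $u\in V(G_1)$ and $v\in V(G_d)$, $2\le d\le n$ (so $d$ is the number of copies of $G$ between $u$ and $v$, inclusive). Then $$r_{F_n(G)}(u,v) = r_G(u,y) + r_G(v,x) +(d-2)\,r_G(x,y) - \frac{\left[r_G(u,x)+r_G(v,y)-r_G(u,y)-r_G(v,x)-2(d-1)\,r_G(x,y)\right]^2}{4n\,r_G(x,y)} .$$ (ii) If $u,v$ are both in the same copy of $G$, then $$r_{F_n(G)}(u,v) = r_G(u,v) - \frac{\left[r_G(u,x)+r_G(v,y)-r_G(u,y)-r_G(v,x)\right]^2}{4n\,r_G(x,y)} .$$ On the right-hand sides, $u$ and $v$ denote the vertices of $G$ corresponding to $u$ and $v$ in the copies of $G$ that contain them.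
   Context: For a connected graph $H$ with vertex set $\{1,\dots,N\}$ and Laplacian matrix $L$, the resistance distance (effective resistance) between vertices $i,j$ is $r_H(i,j)=(e_i-e_j)^T L^\dagger (e_i-e_j)$, where $e_i$ is the $i$th standard unit vector and $L^\dagger$ is the Moore–Penrose pseudoinverse of $L$. Generalized flower graph: let $G$ be a graph, $x\ne y$ two vertices of $G$, and $n\ge 3$. $F_n(G,x,y)$ (written $F_n(G)$) is the graph obtained by taking $n$ vertex-disjoint copies $G_1,\dots,G_n$ of $G$ (the petals), with $x_i,y_i$ the copies of $x,y$ in $G_i$, and identifying $y_i$ with $x_{i+1}$ for $1\le i<n$ and $y_n$ with $x_1$. The vertices $x_1,\dots,x_n$ of $F_n(G)$ are called the associated vertices; each lies in two consecutive petals. -}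

module Defs where

open import Algebra.Bundles using (CommutativeRing)
open import Data.Bool.Base using (if_then_else_)
open import Data.Fin.Base using (Fin; zero; suc; toℕ; combine; punchOut)
open import Data.Fin.Properties as Fin using (any?)
import Data.Integer.Base as ℤ
open import Data.Nat.Base as ℕ using (ℕ; zero; suc)
open import Data.Nat.DivMod using (_mod_; _%_; m<n⇒m%n≡m; n%n≡0; m%n<n)
import Data.Nat.Properties as ℕ
open import Data.Product.Base using (∃; ∃-syntax; _×_; _,_; proj₁)
open import Data.Rational.Base
open import Data.Rational.Properties as ℚ
open import Data.Rational.Solver using (module +-*-Solver)
open import Data.Sum.Base using (inj₁; inj₂)
open import Function.Base using (_∘_)
open import Level using (0ℓ)
open import Relation.Binary.Construct.Closure.ReflexiveTransitive using (Star)
open import Relation.Binary.Core using (Rel)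
open import Relation.Binary.Definitions using (Decidable)
open import Relation.Binary.PropositionalEquality
open import Relation.Nullary using (¬_; yes; no; does; contradiction; _×-dec_)

open import Algebra.Properties.Semiring.Sum (CommutativeRing.semiring +-*-commutativeRing)
open +-*-Solver
open ≡-Reasoning

private variable
  k l m n : ℕ

Matrix : ℕ → ℕ → Set
Matrix m n = Fin m → Fin n → ℚ

infixl 7 _⊗_
_⊗_ : Matrix l m → Matrix m n → Matrix l n
_⊗_ {m = m} A B i k = ∑[ j < m ] (A i j * B j k)

infix 4 _≈_
_≈_ : Matrix m n → Matrix m n → Set
A ≈ B = ∀ i j → A i j ≡ B i j

Symmetric : Matrix n n → Set
Symmetric A = ∀ i j → A i j ≡ A j i

-- The four Penrose conditions have exactly one solution P for each A. The
-- pseudoinverse of a rational matrix is itself rational, and transposition is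
-- conjugate transposition, so ℚ suffices for Laplacians.
record IsMoorePenrose (A : Matrix m n) (P : Matrix n m) : Set where
  field
    APA≈A  : A ⊗ P ⊗ A ≈ A
    PAP≈P  : P ⊗ A ⊗ P ≈ P
    AP-sym : Symmetric (A ⊗ P)
    PA-sym : Symmetric (P ⊗ A)

private
  infixl 7 _∙_
  _∙_ : (f g : Fin n → ℚ) → ℚ
  _∙_ {n} f g = ∑[ i < n ] (f i * g i)

  ∙-cong : {f f′ g g′ : Fin n → ℚ} → f ≗ f′ → g ≗ g′ → f ∙ g ≡ f′ ∙ g′
  ∙-cong p q = sum-cong-≗ λ i → cong₂ _*_ (p i) (q i)

  ∙-comm : (f g : Fin n → ℚ) → f ∙ g ≡ g ∙ f
  ∙-comm f g = sum-cong-≗ λ i → *-comm (f i) (g i)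

  ∙-scaleˡ : ∀ x (f g : Fin n → ℚ) → (λ i → x * f i) ∙ g ≡ x * (f ∙ g)
  ∙-scaleˡ x f g = trans (sum-cong-≗ λ i → *-assoc x (f i) (g i))
                         (sym (*-distribˡ-sum x (λ i → f i * g i)))

  ∙-linˡ : ∀ x (f g h : Fin n → ℚ) → (λ i → f i + x * g i) ∙ h ≡ f ∙ h + x * (g ∙ h)
  ∙-linˡ x f g h = begin
    (λ i → f i + x * g i) ∙ h       ≡⟨ sum-cong-≗ (λ i → *-distribʳ-+ (h i) (f i) (x * g i)) ⟩
    sum (λ i → f i * h i + x * g i * h i)
      ≡⟨ ∑-distrib-+ (λ i → f i * h i) (λ i → x * g i * h i) ⟩
    f ∙ h + (λ i → x * g i) ∙ h     ≡⟨ cong (f ∙ h +_) (∙-scaleˡ x g h) ⟩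
    f ∙ h + x * (g ∙ h)             ∎

  ∙-linʳ : ∀ x (h f g : Fin n → ℚ) → h ∙ (λ i → f i + x * g i) ≡ h ∙ f + x * (h ∙ g)
  ∙-linʳ x h f g = begin
    h ∙ (λ i → f i + x * g i)  ≡⟨ ∙-comm h _ ⟩
    (λ i → f i + x * g i) ∙ h  ≡⟨ ∙-linˡ x f g h ⟩
    f ∙ h + x * (g ∙ h)        ≡⟨ cong₂ (λ p q → p + x * q) (∙-comm f h) (∙-comm g h) ⟩
    h ∙ f + x * (h ∙ g)        ∎

  ∙-assoc : (f : Fin m → ℚ) (M : Matrix m n) (g : Fin n → ℚ) →
            (λ j → f ∙ (λ i → M i j)) ∙ g ≡ f ∙ (λ i → M i ∙ g)
  ∙-assoc {m} {n} f M g = begin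
    ∑[ j < n ] ((f ∙ (λ i → M i j)) * g j)
      ≡⟨ sum-cong-≗ (λ j → *-distribʳ-sum (g j) (λ i → f i * M i j)) ⟩
    ∑[ j < n ] ∑[ i < m ] (f i * M i j * g j)
      ≡⟨ ∑-comm (λ j i → f i * M i j * g j) ⟩
    ∑[ i < m ] ∑[ j < n ] (f i * M i j * g j)
      ≡⟨ sum-cong-≗ (λ i → trans (sum-cong-≗ λ j → *-assoc (f i) (M i j) (g j))
                                 (sym (*-distribˡ-sum (f i) (λ j → M i j * g j)))) ⟩
    f ∙ (λ i → M i ∙ g) ∎

  square-nonneg : ∀ p → 0ℚ ≤ p * p
  square-nonneg p with ≤-total 0ℚ p
  ... | inj₁ 0≤p = nonNegative⁻¹ (p * p) {{nonNeg*nonNeg⇒nonNeg p {{nonNegative 0≤p}} p {{nonNegative 0≤p}}}}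
  ... | inj₂ p≤0 = nonNegative⁻¹ (p * p) {{nonPos*nonPos⇒nonPos p {{nonPositive p≤0}} p {{nonPositive p≤0}}}}

  ∙-nonneg : (f : Fin n → ℚ) → 0ℚ ≤ f ∙ f
  ∙-nonneg {zero}  f = ≤-refl
  ∙-nonneg {suc n} f = +-mono-≤ (square-nonneg (f zero)) (∙-nonneg (λ i → f (suc i)))

  square-zero : ∀ p → p * p ≡ 0ℚ → p ≡ 0ℚ
  square-zero p p²≡0 with p ≟ 0ℚ
  ... | yes p≡0 = p≡0
  ... | no  p≢0 = *-cancelˡ-/0 where
    instance _ = ≢-nonZero p≢0
    *-cancelˡ-/0 : p ≡ 0ℚ
    *-cancelˡ-/0 = begin
      p                ≡⟨ sym (*-identityˡ p) ⟩
      1ℚ * p           ≡⟨ cong (_* p) (sym (*-inverseˡ p)) ⟩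
      1/ p * p * p     ≡⟨ *-assoc (1/ p) p p ⟩
      1/ p * (p * p)   ≡⟨ cong (1/ p *_) p²≡0 ⟩
      1/ p * 0ℚ        ≡⟨ *-zeroʳ (1/ p) ⟩
      0ℚ               ∎

  sum-zero : ∀ {p q} → 0ℚ ≤ p → 0ℚ ≤ q → p + q ≡ 0ℚ → p ≡ 0ℚ
  sum-zero {p} {q} 0≤p 0≤q p+q≡0 = ≤-antisym p≤0 0≤p where
    p≤0 : p ≤ 0ℚ
    p≤0 = subst₂ _≤_ (+-identityʳ p) p+q≡0 (+-monoʳ-≤ p 0≤q)

  ∙-definite : (f : Fin n → ℚ) → f ∙ f ≡ 0ℚ → ∀ i → f i ≡ 0ℚ
  ∙-definite {suc n} f eq zero = square-zero (f zero)
    (sum-zero (square-nonneg (f zero)) (∙-nonneg (λ i → f (suc i))) eq)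
  ∙-definite {suc n} f eq (suc i) = ∙-definite (λ i → f (suc i))
    (sum-zero (∙-nonneg (λ i → f (suc i))) (square-nonneg (f zero)) (trans (+-comm ((λ i → f (suc i)) ∙ (λ i → f (suc i))) (f zero * f zero)) eq)) i

  1+∙-nonzero : (f : Fin n → ℚ) → NonZero (1ℚ + f ∙ f)
  1+∙-nonzero f = pos⇒nonZero (1ℚ + f ∙ f) {{pos+nonNeg⇒pos 1ℚ (f ∙ f) {{nonNegative (∙-nonneg f)}}}}

  ∙-zeroˡ : {f : Fin n → ℚ} (g : Fin n → ℚ) → (∀ i → f i ≡ 0ℚ) → f ∙ g ≡ 0ℚ
  ∙-zeroˡ {n} g f≡0 = trans (sum-cong-≗ λ i → trans (cong (_* g i) (f≡0 i)) (*-zeroˡ (g i)))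
                        (sum-replicate-zero n)

  -- Greville's column-by-column construction.
  module Column (A : Matrix m (suc n)) (P : Matrix n m)
                (isMP : IsMoorePenrose (λ i j → A i (suc j)) P) where
    open IsMoorePenrose isMP

    B : Matrix m n
    B i j = A i (suc j)

    a c : Fin m → ℚ
    d : Fin n → ℚ
    a i = A i zero
    d j = P j ∙ a
    c i = a i + (- 1ℚ) * (B i ∙ d)

    col : Fin n → Fin m → ℚ
    col j i = B i j

    Pcol : Fin m → Fin n → ℚ
    Pcol k j = P j k

    -- Bᵀ B P = Bᵀ
    BᵀBP : ∀ j k → col j ∙ (λ i → (B ⊗ P) i k) ≡ B k j
    BᵀBP j k = begin
      col j ∙ (λ i → (B ⊗ P) i k)   ≡⟨ ∙-comm (col j) _ ⟩
      (λ i → (B ⊗ P) i k) ∙ col j   ≡⟨ ∙-cong (λ i → AP-sym i k) (λ _ → refl) ⟩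
      (B ⊗ P ⊗ B) k j               ≡⟨ APA≈A k j ⟩
      B k j                         ∎

    BPa : ∀ i → (B ⊗ P) i ∙ a ≡ B i ∙ d
    BPa i = ∙-assoc (B i) P a

    Bᵀc : ∀ j → col j ∙ c ≡ 0ℚ
    Bᵀc j = begin
      col j ∙ c
        ≡⟨ ∙-linʳ (- 1ℚ) (col j) a (λ i → B i ∙ d) ⟩
      col j ∙ a + (- 1ℚ) * (col j ∙ (λ i → B i ∙ d))
        ≡⟨ cong (λ z → col j ∙ a + (- 1ℚ) * z) eq ⟩
      col j ∙ a + (- 1ℚ) * (col j ∙ a)
        ≡⟨ solve 1 (λ z → z :+ (:- con 1ℚ) :* z := con 0ℚ) refl (col j ∙ a) ⟩
      0ℚ ∎
      where
      eq : col j ∙ (λ i → B i ∙ d) ≡ col j ∙ a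
      eq = begin
        col j ∙ (λ i → B i ∙ d)                      ≡⟨ ∙-cong {f = col j} (λ _ → refl) (λ i → sym (BPa i)) ⟩
        col j ∙ (λ i → (B ⊗ P) i ∙ a)                ≡⟨ sym (∙-assoc (col j) (B ⊗ P) a) ⟩
        (λ k → col j ∙ (λ i → (B ⊗ P) i k)) ∙ a      ≡⟨ ∙-cong (BᵀBP j) (λ _ → refl) ⟩
        col j ∙ a                                    ∎

    cᵀB : ∀ j → c ∙ col j ≡ 0ℚ
    cᵀB j = trans (∙-comm c (col j)) (Bᵀc j)

    PBd : ∀ j → (P ⊗ B) j ∙ d ≡ d j
    PBd j = begin
      (P ⊗ B) j ∙ d        ≡⟨ sym (∙-assoc ((P ⊗ B) j) P a) ⟩
      (P ⊗ B ⊗ P) j ∙ a    ≡⟨ ∙-cong (PAP≈P j) (λ _ → refl) ⟩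
      d j                  ∎

    Pc : ∀ j → P j ∙ c ≡ 0ℚ
    Pc j = begin
      P j ∙ c
        ≡⟨ ∙-linʳ (- 1ℚ) (P j) a (λ i → B i ∙ d) ⟩
      d j + (- 1ℚ) * (P j ∙ (λ i → B i ∙ d))
        ≡⟨ cong (λ z → d j + (- 1ℚ) * z) (trans (sym (∙-assoc (P j) B d)) (PBd j)) ⟩
      d j + (- 1ℚ) * d j
        ≡⟨ solve 1 (λ z → z :+ (:- con 1ℚ) :* z := con 0ℚ) refl (d j) ⟩
      0ℚ ∎

    Bd : ∀ i → B i ∙ d ≡ a i - c i
    Bd i = solve 2 (λ x y → y := x :- (x :+ (:- con 1ℚ) :* y)) refl (a i) (B i ∙ d)

    module Row (b : Fin m → ℚ) where
      β : ℚ
      β = b ∙ a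

      e : Fin n → ℚ
      e j = b ∙ col j

      Q : Matrix (suc n) m
      Q zero    k = b k
      Q (suc j) k = P j k + (- d j) * b k

      AQ : ∀ i k → (A ⊗ Q) i k ≡ (B ⊗ P) i k + c i * b k
      AQ i k = begin
        a i * b k + B i ∙ (λ j → P j k + (- d j) * b k)
          ≡⟨ cong (a i * b k +_) (∙-cong {f = B i} (λ _ → refl)
               (λ j → cong (P j k +_) (solve 2 (λ x y → (:- x) :* y := (:- y) :* x) refl (d j) (b k)))) ⟩
        a i * b k + B i ∙ (λ j → P j k + (- b k) * d j)
          ≡⟨ cong (a i * b k +_) (∙-linʳ (- b k) (B i) (Pcol k) d) ⟩
        a i * b k + ((B ⊗ P) i k + (- b k) * (B i ∙ d))
          ≡⟨ solve 4 (λ x y z w → x :* y :+ (z :+ (:- y) :* w) := z :+ (x :+ (:- con 1ℚ) :* w) :* y)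
               refl (a i) (b k) ((B ⊗ P) i k) (B i ∙ d) ⟩
        (B ⊗ P) i k + c i * b k ∎

      QA₀ : ∀ i → (Q ⊗ A) (suc i) zero ≡ d i + (- d i) * β
      QA₀ i = ∙-linˡ (- d i) (P i) b a

      QA₊ : ∀ i j → (Q ⊗ A) (suc i) (suc j) ≡ (P ⊗ B) i j + (- d i) * e j
      QA₊ i j = ∙-linˡ (- d i) (P i) b (col j)

      module _ (h₁ : ∀ i k → c i * b k ≡ c k * b i)
               (h₂ : ∀ i → (1ℚ - β) * c i ≡ 0ℚ)
               (h₃ : ∀ j → e j ≡ d j * (1ℚ - β))
               (h₄ : ∀ k → b ∙ (λ i → (B ⊗ P) i k) + (b ∙ c) * b k ≡ b k) where

        AQ-sym : Symmetric (A ⊗ Q)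
        AQ-sym i k = trans (AQ i k) (trans (cong₂ _+_ (AP-sym i k) (h₁ i k)) (sym (AQ k i)))

        edge : ∀ i → (Q ⊗ A) zero (suc i) ≡ (Q ⊗ A) (suc i) zero
        edge i = begin
          e i                  ≡⟨ h₃ i ⟩
          d i * (1ℚ - β)       ≡⟨ solve 2 (λ x y → x :* (con 1ℚ :- y) := x :+ (:- x) :* y) refl (d i) β ⟩
          d i + (- d i) * β    ≡⟨ sym (QA₀ i) ⟩
          (Q ⊗ A) (suc i) zero ∎

        QA-sym : Symmetric (Q ⊗ A)
        QA-sym zero    zero    = refl
        QA-sym zero    (suc j) = edge j
        QA-sym (suc i) zero    = sym (edge i)
        QA-sym (suc i) (suc j) = begin
          (Q ⊗ A) (suc i) (suc j)        ≡⟨ QA₊ i j ⟩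
          (P ⊗ B) i j + (- d i) * e j    ≡⟨ cong₂ (λ p q → p + (- d i) * q) (PA-sym i j) (h₃ j) ⟩
          (P ⊗ B) j i + (- d i) * (d j * (1ℚ - β))
            ≡⟨ solve 4 (λ x y z w → x :+ (:- y) :* (z :* w) := x :+ (:- z) :* (y :* w))
                 refl ((P ⊗ B) j i) (d i) (d j) (1ℚ - β) ⟩
          (P ⊗ B) j i + (- d j) * (d i * (1ℚ - β))
            ≡⟨ cong (λ q → (P ⊗ B) j i + (- d j) * q) (sym (h₃ i)) ⟩
          (P ⊗ B) j i + (- d j) * e i    ≡⟨ sym (QA₊ j i) ⟩
          (Q ⊗ A) (suc j) (suc i)        ∎

        ce : ∀ i j → c i * e j ≡ 0ℚ
        ce i j = begin
          c i * e j                 ≡⟨ cong (c i *_) (h₃ j) ⟩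
          c i * (d j * (1ℚ - β))    ≡⟨ solve 3 (λ x y z → x :* (y :* z) := y :* (z :* x)) refl (c i) (d j) (1ℚ - β) ⟩
          d j * ((1ℚ - β) * c i)    ≡⟨ cong (d j *_) (h₂ i) ⟩
          d j * 0ℚ                  ≡⟨ *-zeroʳ (d j) ⟩
          0ℚ                        ∎

        AQA : A ⊗ Q ⊗ A ≈ A
        AQA i j = trans (∙-assoc (A i) Q (λ k → A k j)) (go j) where
          go : ∀ j → (A ⊗ (Q ⊗ A)) i j ≡ A i j
          go zero = begin
            a i * β + B i ∙ (λ k → (Q ⊗ A) (suc k) zero)
              ≡⟨ cong (a i * β +_) (∙-cong {f = B i} (λ _ → refl) (λ k →
                   trans (QA₀ k) (cong (d k +_) (solve 2 (λ x y → (:- x) :* y := (:- y) :* x) refl (d k) β)))) ⟩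
            a i * β + B i ∙ (λ k → d k + (- β) * d k)
              ≡⟨ cong (a i * β +_) (∙-linʳ (- β) (B i) d d) ⟩
            a i * β + (B i ∙ d + (- β) * (B i ∙ d))
              ≡⟨ cong (λ z → a i * β + (z + (- β) * z)) (Bd i) ⟩
            a i * β + ((a i - c i) + (- β) * (a i - c i))
              ≡⟨ solve 3 (λ x y z → x :* z :+ ((x :- y) :+ (:- z) :* (x :- y)) := x :- (con 1ℚ :- z) :* y)
                   refl (a i) (c i) β ⟩
            a i - (1ℚ - β) * c i
              ≡⟨ cong (λ z → a i - z) (h₂ i) ⟩
            a i - 0ℚ
              ≡⟨ +-identityʳ (a i) ⟩
            a i ∎
          go (suc j) = begin
            a i * e j + B i ∙ (λ k → (Q ⊗ A) (suc k) (suc j))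
              ≡⟨ cong (a i * e j +_) (∙-cong {f = B i} (λ _ → refl) (λ k →
                   trans (QA₊ k j) (cong ((P ⊗ B) k j +_) (solve 2 (λ x y → (:- x) :* y := (:- y) :* x) refl (d k) (e j))))) ⟩
            a i * e j + B i ∙ (λ k → (P ⊗ B) k j + (- e j) * d k)
              ≡⟨ cong (a i * e j +_) (∙-linʳ (- e j) (B i) (λ k → (P ⊗ B) k j) d) ⟩
            a i * e j + ((B ⊗ (P ⊗ B)) i j + (- e j) * (B i ∙ d))
              ≡⟨ cong₂ (λ z w → a i * e j + (z + (- e j) * w))
                   (trans (sym (∙-assoc (B i) P (col j))) (APA≈A i j)) (Bd i) ⟩
            a i * e j + (B i j + (- e j) * (a i - c i))
              ≡⟨ solve 4 (λ x y z w → x :* y :+ (w :+ (:- y) :* (x :- z)) := w :+ z :* y)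
                   refl (a i) (e j) (c i) (B i j) ⟩
            B i j + c i * e j
              ≡⟨ cong (B i j +_) (ce i j) ⟩
            B i j + 0ℚ
              ≡⟨ +-identityʳ (B i j) ⟩
            B i j ∎

        bAQ : ∀ k → b ∙ (λ i → (A ⊗ Q) i k) ≡ b k
        bAQ k = begin
          b ∙ (λ i → (A ⊗ Q) i k)
            ≡⟨ ∙-cong {f = b} (λ _ → refl) (λ i → trans (AQ i k) (cong ((B ⊗ P) i k +_) (*-comm (c i) (b k)))) ⟩
          b ∙ (λ i → (B ⊗ P) i k + b k * c i)
            ≡⟨ ∙-linʳ (b k) b (λ i → (B ⊗ P) i k) c ⟩
          b ∙ (λ i → (B ⊗ P) i k) + b k * (b ∙ c)
            ≡⟨ cong (b ∙ (λ i → (B ⊗ P) i k) +_) (*-comm (b k) (b ∙ c)) ⟩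
          b ∙ (λ i → (B ⊗ P) i k) + (b ∙ c) * b k
            ≡⟨ h₄ k ⟩
          b k ∎

        PAQ : ∀ j k → P j ∙ (λ i → (A ⊗ Q) i k) ≡ P j k
        PAQ j k = begin
          P j ∙ (λ i → (A ⊗ Q) i k)
            ≡⟨ ∙-cong {f = P j} (λ _ → refl) (λ i → trans (AQ i k) (cong ((B ⊗ P) i k +_) (*-comm (c i) (b k)))) ⟩
          P j ∙ (λ i → (B ⊗ P) i k + b k * c i)
            ≡⟨ ∙-linʳ (b k) (P j) (λ i → (B ⊗ P) i k) c ⟩
          (P ⊗ (B ⊗ P)) j k + b k * (P j ∙ c)
            ≡⟨ cong₂ (λ z w → z + b k * w)
                 (trans (sym (∙-assoc (P j) B (Pcol k))) (PAP≈P j k)) (Pc j) ⟩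
          P j k + b k * 0ℚ
            ≡⟨ solve 2 (λ x y → x :+ y :* con 0ℚ := x) refl (P j k) (b k) ⟩
          P j k ∎

        QAQ : Q ⊗ A ⊗ Q ≈ Q
        QAQ j k = trans (∙-assoc (Q j) A (λ i → Q i k)) (go j) where
          go : ∀ j → (Q ⊗ (A ⊗ Q)) j k ≡ Q j k
          go zero    = bAQ k
          go (suc j) = trans (∙-linˡ (- d j) (P j) b (λ i → (A ⊗ Q) i k))
                             (cong₂ (λ z w → z + (- d j) * w) (PAQ j k) (bAQ k))

        isMoorePenrose : IsMoorePenrose A Q
        isMoorePenrose = record
          { APA≈A = AQA ; PAP≈P = QAQ ; AP-sym = AQ-sym ; PA-sym = QA-sym }

    c∙a : c ∙ a ≡ c ∙ c
    c∙a = begin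
      c ∙ a
        ≡⟨ ∙-cong {f = c} (λ _ → refl) (λ i → solve 2 (λ x y → x := (x :+ (:- con 1ℚ) :* y) :+ con 1ℚ :* y) refl (a i) (B i ∙ d)) ⟩
      c ∙ (λ i → c i + 1ℚ * (B i ∙ d))
        ≡⟨ ∙-linʳ 1ℚ c c (λ i → B i ∙ d) ⟩
      c ∙ c + 1ℚ * (c ∙ (λ i → B i ∙ d))
        ≡⟨ cong (λ z → c ∙ c + 1ℚ * z) (trans (sym (∙-assoc c B d)) (∙-zeroˡ d cᵀB)) ⟩
      c ∙ c + 1ℚ * 0ℚ
        ≡⟨ +-identityʳ (c ∙ c) ⟩
      c ∙ c ∎

    cᵀBP : ∀ k → c ∙ (λ i → (B ⊗ P) i k) ≡ 0ℚ
    cᵀBP k = trans (sym (∙-assoc c B (Pcol k))) (∙-zeroˡ (Pcol k) cᵀB)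

    independent : c ∙ c ≢ 0ℚ → ∃ (IsMoorePenrose A)
    independent c∙c≢0 = Row.Q b , Row.isMoorePenrose b h₁ h₂ h₃ h₄ where
      instance _ = ≢-nonZero c∙c≢0
      s : ℚ
      s = 1/ (c ∙ c)
      b : Fin m → ℚ
      b i = s * c i
      β≡1 : b ∙ a ≡ 1ℚ
      β≡1 = trans (∙-scaleˡ s c a) (trans (cong (s *_) c∙a) (*-inverseˡ (c ∙ c)))
      h₁ : ∀ i k → c i * b k ≡ c k * b i
      h₁ i k = solve 3 (λ x y z → x :* (z :* y) := y :* (z :* x)) refl (c i) (c k) s
      h₂ : ∀ i → (1ℚ - b ∙ a) * c i ≡ 0ℚ
      h₂ i = trans (cong (λ z → (1ℚ - z) * c i) β≡1) (*-zeroˡ (c i))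
      h₃ : ∀ j → b ∙ col j ≡ d j * (1ℚ - b ∙ a)
      h₃ j = begin
        b ∙ col j            ≡⟨ ∙-scaleˡ s c (col j) ⟩
        s * (c ∙ col j)      ≡⟨ cong (s *_) (cᵀB j) ⟩
        s * 0ℚ               ≡⟨ *-zeroʳ s ⟩
        0ℚ                   ≡⟨ sym (*-zeroʳ (d j)) ⟩
        d j * (1ℚ - 1ℚ)      ≡⟨ cong (λ z → d j * (1ℚ - z)) (sym β≡1) ⟩
        d j * (1ℚ - b ∙ a)   ∎
      h₄ : ∀ k → b ∙ (λ i → (B ⊗ P) i k) + (b ∙ c) * b k ≡ b k
      h₄ k = begin
        b ∙ (λ i → (B ⊗ P) i k) + (b ∙ c) * b k
          ≡⟨ cong₂ (λ z w → z + w * b k)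
               (trans (∙-scaleˡ s c (λ i → (B ⊗ P) i k)) (cong (s *_) (cᵀBP k)))
               (trans (∙-scaleˡ s c c) (*-inverseˡ (c ∙ c))) ⟩
        s * 0ℚ + 1ℚ * b k
          ≡⟨ solve 2 (λ x y → x :* con 0ℚ :+ con 1ℚ :* y := y) refl s (b k) ⟩
        b k ∎

    dependent : c ∙ c ≡ 0ℚ → ∃ (IsMoorePenrose A)
    dependent c∙c≡0 = Row.Q b , Row.isMoorePenrose b h₁ h₂ h₃ h₄ where
      instance _ = 1+∙-nonzero d
      c≡0 : ∀ i → c i ≡ 0ℚ
      c≡0 = ∙-definite c c∙c≡0
      s : ℚ
      s = 1/ (1ℚ + d ∙ d)
      b : Fin m → ℚ
      b k = s * (d ∙ Pcol k)
      β≡sδ : b ∙ a ≡ s * (d ∙ d)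
      β≡sδ = trans (∙-scaleˡ s (λ k → d ∙ Pcol k) a) (cong (s *_) (∙-assoc d P a))
      1-β≡s : 1ℚ - b ∙ a ≡ s
      1-β≡s = begin
        1ℚ - b ∙ a                        ≡⟨ cong (λ z → 1ℚ - z) β≡sδ ⟩
        1ℚ - s * (d ∙ d)                  ≡⟨ cong (_- s * (d ∙ d)) (sym (*-inverseˡ (1ℚ + d ∙ d))) ⟩
        s * (1ℚ + d ∙ d) - s * (d ∙ d)    ≡⟨ solve 2 (λ x y → x :* (con 1ℚ :+ y) :- x :* y := x) refl s (d ∙ d) ⟩
        s                                 ∎
      h₁ : ∀ i k → c i * b k ≡ c k * b i
      h₁ i k = begin
        c i * b k   ≡⟨ cong (_* b k) (c≡0 i) ⟩
        0ℚ * b k    ≡⟨ *-zeroˡ (b k) ⟩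
        0ℚ          ≡⟨ sym (*-zeroˡ (b i)) ⟩
        0ℚ * b i    ≡⟨ cong (_* b i) (sym (c≡0 k)) ⟩
        c k * b i   ∎
      h₂ : ∀ i → (1ℚ - b ∙ a) * c i ≡ 0ℚ
      h₂ i = trans (cong ((1ℚ - b ∙ a) *_) (c≡0 i)) (*-zeroʳ (1ℚ - b ∙ a))
      dPB : ∀ j → (λ k → d ∙ Pcol k) ∙ col j ≡ d j
      dPB j = begin
        (λ k → d ∙ Pcol k) ∙ col j     ≡⟨ ∙-assoc d P (col j) ⟩
        d ∙ (λ i → (P ⊗ B) i j)        ≡⟨ ∙-comm d _ ⟩
        (λ i → (P ⊗ B) i j) ∙ d        ≡⟨ ∙-cong (λ i → PA-sym i j) (λ _ → refl) ⟩
        (P ⊗ B) j ∙ d                  ≡⟨ PBd j ⟩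
        d j                            ∎
      bB : ∀ j → b ∙ col j ≡ s * d j
      bB j = trans (∙-scaleˡ s (λ k → d ∙ Pcol k) (col j)) (cong (s *_) (dPB j))
      h₃ : ∀ j → b ∙ col j ≡ d j * (1ℚ - b ∙ a)
      h₃ j = trans (bB j) (trans (*-comm s (d j)) (cong (d j *_) (sym 1-β≡s)))
      h₄ : ∀ k → b ∙ (λ i → (B ⊗ P) i k) + (b ∙ c) * b k ≡ b k
      h₄ k = begin
        b ∙ (λ i → (B ⊗ P) i k) + (b ∙ c) * b k
          ≡⟨ cong₂ (λ z w → z + w * b k)
               (trans (sym (∙-assoc b B (Pcol k)))
                 (trans (∙-cong bB (λ _ → refl)) (∙-scaleˡ s d (Pcol k))))
               (trans (∙-comm b c) (∙-zeroˡ b c≡0)) ⟩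
        b k + 0ℚ * b k
          ≡⟨ solve 1 (λ y → y :+ con 0ℚ :* y := y) refl (b k) ⟩
        b k ∎

    extend : ∃ (IsMoorePenrose A)
    extend with c ∙ c ≟ 0ℚ
    ... | yes c∙c≡0 = dependent c∙c≡0
    ... | no  c∙c≢0 = independent c∙c≢0

abstract
  moorePenrose : (A : Matrix m n) → ∃ (IsMoorePenrose A)
  moorePenrose {m} {zero} A = (λ ()) , record
    { APA≈A  = λ _ ()
    ; PAP≈P  = λ ()
    ; AP-sym = λ _ _ → refl
    ; PA-sym = λ ()
    }
  moorePenrose {m} {suc n} A with P , isMP ← moorePenrose (λ i j → A i (suc j)) =
    Column.extend A P isMP

fromℕ : ℕ → ℚ
fromℕ n = ℤ.+ n / 1

infix 9 _²
_² : ℚ → ℚ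
p ² = p * p

record Graph (n : ℕ) : Set₁ where
  infix 4 _~_ _~?_
  field
    _~_      : Rel (Fin n) 0ℓ
    _~?_     : Decidable _~_
    ~-sym    : ∀ {u v} → u ~ v → v ~ u
    ~-irrefl : ∀ {v} → ¬ v ~ v

Connected : Graph n → Set
Connected G = ∀ u v → Star _~_ u v
  where open Graph G

adjacency : Graph n → Matrix n n
adjacency G u v = if does (u ~? v) then 1ℚ else 0ℚ
  where open Graph G

degree : Graph n → Fin n → ℚ
degree {n} G u = ∑[ v < n ] adjacency G u v

laplacian : Graph n → Matrix n n
laplacian G u v = (if does (u Fin.≟ v) then degree G u else 0ℚ) - adjacency G u v

pseudoinverse : Matrix m n → Matrix n m
pseudoinverse A = proj₁ (moorePenrose A)

unit : Fin n → Fin n → ℚ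
unit i k = if does (i Fin.≟ k) then 1ℚ else 0ℚ

resistance : Graph n → Fin n → Fin n → ℚ
resistance {n} G i j =
  ∑[ k < n ] (δ k * ∑[ l < n ] (pseudoinverse (laplacian G) k l * δ l))
  where
  δ : Fin n → ℚ
  δ k = unit i k - unit j k

module Flower (G : Graph (suc m)) {x y : Fin (suc m)} (x≢y : x ≢ y)
              (n : ℕ) (3≤n : 3 ℕ.≤ n) where
  open Graph G

  private instance
    n≢0 : ℕ.NonZero n
    n≢0 = ℕ.>-nonZero (ℕ.≤-trans (ℕ.s≤s ℕ.z≤n) 3≤n)

  rotate : Fin n → ℕ → Fin n
  rotate i k = (toℕ i ℕ.+ k) mod n

  -- Each vertex of the flower is represented once, in the unique petal where it
  -- is not the copy of y: combine i k stands for the vertex punchIn y k of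
  -- petal i. `petal i v` is the image of v's i-th copy after identification, so
  -- petal i y is petal (i + 1) x, and every vertex is of the form petal i v.
  petal : Fin n → Fin (suc m) → Fin (n ℕ.* m)
  petal i v with y Fin.≟ v
  ... | yes _   = combine (rotate i 1) (punchOut (x≢y ∘ sym))
  ... | no  y≢v = combine i (punchOut y≢v)

  private
    rotate≢ : ∀ i → rotate i 1 ≢ i
    rotate≢ i eq with toℕ i ℕ.+ 1 ℕ.<? n
    ... | yes i+1<n = ℕ.m+1+n≢m (toℕ i) (trans (sym (m<n⇒m%n≡m i+1<n)) [i+1]%n≡i)
      where
      [i+1]%n≡i : (toℕ i ℕ.+ 1) % n ≡ toℕ i
      [i+1]%n≡i = trans (sym (Fin.toℕ-fromℕ< (m%n<n (toℕ i ℕ.+ 1) n))) (cong toℕ eq)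
    ... | no  i+1≮n = ℕ.<⇒≱ (ℕ.≤-trans (ℕ.s≤s (ℕ.s≤s ℕ.z≤n)) 3≤n) (ℕ.≤-reflexive n≡1)
      where
      i+1≡n : toℕ i ℕ.+ 1 ≡ n
      i+1≡n = ℕ.≤-antisym (subst (ℕ._≤ n) (ℕ.+-comm 1 (toℕ i)) (Fin.toℕ<n i)) (ℕ.≮⇒≥ i+1≮n)
      i≡0 : toℕ i ≡ 0
      i≡0 = trans (sym (cong toℕ eq)) (trans (Fin.toℕ-fromℕ< (m%n<n (toℕ i ℕ.+ 1) n))
              (trans (cong (_% n) i+1≡n) (n%n≡0 n)))
      n≡1 : n ≡ 1
      n≡1 = trans (sym i+1≡n) (cong (ℕ._+ 1) i≡0)

  petal-injective : ∀ i {u v} → petal i u ≡ petal i v → u ≡ v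
  petal-injective i {u} {v} eq with y Fin.≟ u | y Fin.≟ v
  ... | yes y≡u | yes y≡v = trans (sym y≡u) y≡v
  ... | yes _   | no  _   = contradiction (Fin.combine-injectiveˡ _ _ _ _ eq) (rotate≢ i)
  ... | no  _   | yes _   = contradiction (sym (Fin.combine-injectiveˡ _ _ _ _ eq)) (rotate≢ i)
  ... | no  y≢u | no  y≢v = Fin.punchOut-injective y≢u y≢v (Fin.combine-injectiveʳ i _ i _ eq)

  -- For n ≥ 3 two distinct vertices lie in at most one common petal, so the
  -- identification never merges edges.
  flower : Graph (n ℕ.* m)
  flower = record
    { _~_      = λ a b → ∃[ i ] ∃[ u ] ∃[ v ] (u ~ v × petal i u ≡ a × petal i v ≡ b)
    ; _~?_     = λ a b → any? λ i → any? λ u → any? λ v →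
                   u ~? v ×-dec petal i u Fin.≟ a ×-dec petal i v Fin.≟ b
    ; ~-sym    = λ (i , u , v , u~v , iu≡a , iv≡b) → i , v , u , ~-sym u~v , iv≡b , iu≡a
    ; ~-irrefl = λ (i , u , v , u~v , iu≡a , iv≡a) →
                   ~-irrefl (subst (u ~_) (sym (petal-injective i (trans iu≡a (sym iv≡a)))) u~v)
    }

{-# OPTIONS --safe #-}
module Submission where

-- If Lφ = e_a − e_b then r(a,b) = φ(a) − φ(b), so it suffices to exhibit a
-- potential on the flower, glued from potentials on the petals. Send a unit
-- current from a to b along a route through the petals, using in each petal the
-- potential of G for the terminals the route visits there, and superpose a
-- circulation t, that is, t times the potential h of a unit current from x to y in
-- every petal. The circulation adds no net current at the associated vertices, and
-- t is fixed by demanding that the potential drops around the cycle sum to zero: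
-- n t r(x,y) = −D, where D is the total drop of the route. By reciprocity
-- the circulation changes the potential difference of a and b by
-- tD = −D²/(n r(x,y)), and polarisation of r expresses D through resistances of G.

open import Algebra.Bundles using (CommutativeRing)
open import Data.Bool.Base using (if_then_else_; true; false)
open import Data.Fin.Base using (Fin; zero; suc; toℕ; fromℕ<; combine; remQuot; punchIn; punchOut)
open import Data.Fin.Permutation using (Permutation; permutation)
open import Data.Fin.Properties as Fin using ()
import Data.Integer.Base as ℤ
import Data.Integer.Properties as ℤ
open import Data.Nat.Base as ℕ using (ℕ; zero; suc; _∸_)
open import Data.Nat.DivMod using (_%_; m<n⇒m%n≡m; n%n≡0; m%n<n; m%n%n≡m%n; [m+n]%n≡m%n; %-distribˡ-+)
import Data.Nat.Properties as ℕ
open import Data.Product.Base using (Σ-syntax; _×_; _,_; proj₁; proj₂; uncurry)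
open import Data.Rational.Base
  using (ℚ; 0ℚ; 1ℚ; NonZero; nonNegative; nonPositive; ≢-nonZero; _+_; _-_; _*_; _÷_; -_; 1/_; _≤_)
open import Data.Rational.Properties
open import Data.Rational.Solver using (module +-*-Solver)
import Data.Rational.Unnormalised.Base as ℚᵘ
import Data.Rational.Unnormalised.Properties as ℚᵘ
open import Data.Sum.Base using (_⊎_; inj₁; inj₂)
open import Data.Vec.Functional using (removeAt)
open import Defs
open import Function.Base using (_∘_; const)
open import Relation.Binary.Construct.Closure.ReflexiveTransitive using (Star; ε; _◅_)
open import Relation.Binary.PropositionalEquality
open import Relation.Nullary using (¬_; Dec; yes; no; does; contradiction)
open import Relation.Nullary.Decidable using (dec-true; dec-false)

open import Algebra.Properties.Semiring.Sum (CommutativeRing.semiring +-*-commutativeRing)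
open +-*-Solver
open ≡-Reasoning

private variable
  l m n : ℕ

-- Rational arithmetic and finite sums.

-- `ℤ.+ n / 1` normalises by a gcd and is stuck for variable `n`, so the equation is checked on
-- unnormalised rationals.
fromℕ-suc : ∀ n → fromℕ (suc n) ≡ 1ℚ + fromℕ n
fromℕ-suc n = toℚᵘ-injective (ℚᵘ.≃-trans (toℚᵘ-fromℚᵘ (ℚᵘ.mkℚᵘ (ℤ.+ suc n) 0))
  (ℚᵘ.≃-sym (ℚᵘ.≃-trans (toℚᵘ-homo-+ 1ℚ (fromℕ n))
    (ℚᵘ.≃-trans (ℚᵘ.+-congʳ ℚᵘ.1ℚᵘ (toℚᵘ-fromℚᵘ (ℚᵘ.mkℚᵘ (ℤ.+ n) 0)))
      (ℚᵘ.*≡* (trans (ℤ.*-identityʳ _) (trans (cong (ℤ._+_ ℤ.1ℤ) (ℤ.*-identityʳ (ℤ.+ n))) (sym (ℤ.*-identityʳ (ℤ.+ suc n))))))))))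

fromℕ-+ : ∀ m n → fromℕ (m ℕ.+ n) ≡ fromℕ m + fromℕ n
fromℕ-+ zero    n = sym (+-identityˡ (fromℕ n))
fromℕ-+ (suc m) n = begin
  fromℕ (suc (m ℕ.+ n))         ≡⟨ fromℕ-suc (m ℕ.+ n) ⟩
  1ℚ + fromℕ (m ℕ.+ n)          ≡⟨ cong (1ℚ +_) (fromℕ-+ m n) ⟩
  1ℚ + (fromℕ m + fromℕ n)      ≡⟨ sym (+-assoc 1ℚ (fromℕ m) (fromℕ n)) ⟩
  1ℚ + fromℕ m + fromℕ n        ≡⟨ cong (_+ fromℕ n) (sym (fromℕ-suc m)) ⟩
  fromℕ (suc m) + fromℕ n       ∎

fromℕ-* : ∀ m n → fromℕ (m ℕ.* n) ≡ fromℕ m * fromℕ n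
fromℕ-* zero    n = sym (*-zeroˡ (fromℕ n))
fromℕ-* (suc m) n = begin
  fromℕ (n ℕ.+ m ℕ.* n)         ≡⟨ fromℕ-+ n (m ℕ.* n) ⟩
  fromℕ n + fromℕ (m ℕ.* n)     ≡⟨ cong (fromℕ n +_) (fromℕ-* m n) ⟩
  fromℕ n + fromℕ m * fromℕ n   ≡⟨ solve 2 (λ p q → q :+ p :* q := (con 1ℚ :+ p) :* q) refl (fromℕ m) (fromℕ n) ⟩
  (1ℚ + fromℕ m) * fromℕ n      ≡⟨ cong (_* fromℕ n) (sym (fromℕ-suc m)) ⟩
  fromℕ (suc m) * fromℕ n       ∎

fromℕ-nonneg : ∀ n → 0ℚ ≤ fromℕ n
fromℕ-nonneg zero    = ≤-refl
fromℕ-nonneg (suc n) = subst (0ℚ ≤_) (sym (fromℕ-suc n))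
  (+-mono-≤ {0ℚ} {1ℚ} (nonNegative⁻¹ 1ℚ) (fromℕ-nonneg n))

fromℕ≢0 : ∀ n .{{_ : ℕ.NonZero n}} → fromℕ n ≢ 0ℚ
fromℕ≢0 (suc n) eq = contradiction
  (subst (1ℚ ≤_) (trans (sym (fromℕ-suc n)) eq) (subst (_≤ 1ℚ + fromℕ n) (+-identityʳ 1ℚ) (+-monoʳ-≤ 1ℚ (fromℕ-nonneg n))))
  λ { (_≤_.*≤* (ℤ.+≤+ ())) }

*-cancel-0 : ∀ p {q} → p ≢ 0ℚ → p * q ≡ 0ℚ → q ≡ 0ℚ
*-cancel-0 p {q} p≢0 pq≡0 = begin
  q                ≡⟨ sym (*-identityˡ q) ⟩
  1ℚ * q           ≡⟨ cong (_* q) (sym (*-inverseˡ p)) ⟩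
  1/ p * p * q     ≡⟨ *-assoc (1/ p) p q ⟩
  1/ p * (p * q)   ≡⟨ cong (1/ p *_) pq≡0 ⟩
  1/ p * 0ℚ        ≡⟨ *-zeroʳ (1/ p) ⟩
  0ℚ               ∎
  where instance _ = ≢-nonZero p≢0

*-≢0 : ∀ {p q} → p ≢ 0ℚ → q ≢ 0ℚ → p * q ≢ 0ℚ
*-≢0 {p} p≢0 q≢0 pq≡0 = q≢0 (*-cancel-0 p p≢0 pq≡0)

p-q≡0⇒p≡q : ∀ p q → p - q ≡ 0ℚ → p ≡ q
p-q≡0⇒p≡q p q eq = begin
  p            ≡⟨ solve 2 (λ p q → p := (p :- q) :+ q) refl p q ⟩
  p - q + q    ≡⟨ cong (_+ q) eq ⟩
  0ℚ + q       ≡⟨ +-identityˡ q ⟩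
  q            ∎

²-nonneg : ∀ p → 0ℚ ≤ p ²
²-nonneg p with ≤-total 0ℚ p
... | inj₁ 0≤p = nonNegative⁻¹ (p ²) {{nonNeg*nonNeg⇒nonNeg p {{nonNegative 0≤p}} p {{nonNegative 0≤p}}}}
... | inj₂ p≤0 = nonNegative⁻¹ (p ²) {{nonPos*nonPos⇒nonPos p {{nonPositive p≤0}} p {{nonPositive p≤0}}}}

²≡0⇒≡0 : ∀ p → p ² ≡ 0ℚ → p ≡ 0ℚ
²≡0⇒≡0 p p²≡0 with p ≟ 0ℚ
... | yes p≡0 = p≡0
... | no  p≢0 = *-cancel-0 p p≢0 p²≡0

sum-≡0 : {f : Fin n → ℚ} → (∀ i → f i ≡ 0ℚ) → sum f ≡ 0ℚ
sum-≡0 {n} f≡0 = trans (sum-cong-≗ f≡0) (sum-replicate-zero n)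

sum-single : (f : Fin n → ℚ) (i : Fin n) → (∀ j → j ≢ i → f j ≡ 0ℚ) → sum f ≡ f i
sum-single {suc n} f i f≡0 = begin
  sum f                     ≡⟨ sum-remove {i = i} f ⟩
  f i + sum (removeAt f i)  ≡⟨ cong (f i +_) (sum-≡0 λ j → f≡0 _ (Fin.punchInᵢ≢i i j)) ⟩
  f i + 0ℚ                  ≡⟨ +-identityʳ (f i) ⟩
  f i                       ∎

sum-const : ∀ n p → sum {n} (const p) ≡ fromℕ n * p
sum-const zero    p = sym (*-zeroˡ p)
sum-const (suc n) p = begin
  p + sum {n} (const p)  ≡⟨ cong (p +_) (sum-const n p) ⟩
  p + fromℕ n * p        ≡⟨ solve 2 (λ k p → p :+ k :* p := (con 1ℚ :+ k) :* p) refl (fromℕ n) p ⟩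
  (1ℚ + fromℕ n) * p     ≡⟨ cong (_* p) (sym (fromℕ-suc n)) ⟩
  fromℕ (suc n) * p      ∎

∑-distrib-sub : (f g : Fin n → ℚ) → ∑[ i < n ] (f i - g i) ≡ sum f - sum g
∑-distrib-sub {zero}  f g = refl
∑-distrib-sub {suc n} f g = begin
  f zero - g zero + ∑[ i < n ] (f (suc i) - g (suc i))
    ≡⟨ cong (f zero - g zero +_) (∑-distrib-sub (f ∘ suc) (g ∘ suc)) ⟩
  f zero - g zero + (sum (f ∘ suc) - sum (g ∘ suc))
    ≡⟨ solve 4 (λ a b c d → a :- b :+ (c :- d) := (a :+ c) :- (b :+ d)) refl
         (f zero) (g zero) (sum (f ∘ suc)) (sum (g ∘ suc)) ⟩
  sum f - sum g ∎

sum-nonneg : (f : Fin n → ℚ) → (∀ i → 0ℚ ≤ f i) → 0ℚ ≤ sum f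
sum-nonneg {zero}  f 0≤f = ≤-refl
sum-nonneg {suc n} f 0≤f = +-mono-≤ (0≤f zero) (sum-nonneg (f ∘ suc) (0≤f ∘ suc))

sum-nonneg-≡0 : (f : Fin n → ℚ) → (∀ i → 0ℚ ≤ f i) → sum f ≡ 0ℚ → ∀ i → f i ≡ 0ℚ
sum-nonneg-≡0 {suc n} f 0≤f ∑f≡0 i = ≤-antisym fi≤0 (0≤f i) where
  fi≤0 : f i ≤ 0ℚ
  fi≤0 = subst₂ _≤_ (+-identityʳ (f i)) (trans (sym (sum-remove {i = i} f)) ∑f≡0)
    (+-monoʳ-≤ (f i) (sum-nonneg (removeAt f i) λ j → 0≤f _))

-- `sum` unfolds at its first term, whereas the accumulated potential drops around the flower grow
-- at the last one.
sum-snoc : ∀ (f : ℕ → ℚ) k → ∑[ i < suc k ] f (toℕ i) ≡ ∑[ i < k ] f (toℕ i) + f k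
sum-snoc f zero    = +-comm (f 0) 0ℚ
sum-snoc f (suc k) = trans (cong (f 0 +_) (sum-snoc (f ∘ suc) k))
  (sym (+-assoc (f 0) (∑[ i < k ] f (suc (toℕ i))) (f (suc k))))

sum-telescope : ∀ (f : ℕ → ℚ) n → ∑[ k < n ] (f (toℕ k) - f (suc (toℕ k))) ≡ f 0 - f n
sum-telescope f zero    = sym (+-inverseʳ (f 0))
sum-telescope f (suc n) = trans (cong (f 0 - f 1 +_) (sum-telescope (f ∘ suc) n))
  (solve 3 (λ a b c → a :- b :+ (b :- c) := a :- c) refl (f 0) (f 1) (f (suc n)))

-- Unit vectors, inner products and matrix action.

unit-≡ : (i : Fin n) → unit i i ≡ 1ℚ
unit-≡ i = cong (if_then 1ℚ else 0ℚ) (dec-true (i Fin.≟ i) refl)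

unit-≢ : {i j : Fin n} → i ≢ j → unit i j ≡ 0ℚ
unit-≢ {i = i} {j} i≢j = cong (if_then 1ℚ else 0ℚ) (dec-false (i Fin.≟ j) i≢j)

infix 8 _•_ _▹_
_•_ : (f g : Fin n → ℚ) → ℚ
_•_ {n} f g = ∑[ i < n ] (f i * g i)

_▹_ : Matrix m n → (Fin n → ℚ) → Fin m → ℚ
(A ▹ f) i = A i • f

•-congˡ : {f f′ : Fin n → ℚ} (g : Fin n → ℚ) → f ≗ f′ → f • g ≡ f′ • g
•-congˡ g f≗f′ = sum-cong-≗ λ i → cong (_* g i) (f≗f′ i)

•-congʳ : (f : Fin n → ℚ) {g g′ : Fin n → ℚ} → g ≗ g′ → f • g ≡ f • g′
•-congʳ f g≗g′ = sum-cong-≗ λ i → cong (f i *_) (g≗g′ i)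

•-comm : (f g : Fin n → ℚ) → f • g ≡ g • f
•-comm f g = sum-cong-≗ λ i → *-comm (f i) (g i)

•-linʳ : (f g h : Fin n → ℚ) (t : ℚ) → f • (λ i → g i + t * h i) ≡ f • g + t * (f • h)
•-linʳ f g h t = begin
  f • (λ i → g i + t * h i)
    ≡⟨ sum-cong-≗ (λ i → solve 4 (λ f g h t → f :* (g :+ t :* h) := f :* g :+ t :* (f :* h)) refl (f i) (g i) (h i) t) ⟩
  sum (λ i → f i * g i + t * (f i * h i))
    ≡⟨ ∑-distrib-+ (λ i → f i * g i) (λ i → t * (f i * h i)) ⟩
  f • g + sum (λ i → t * (f i * h i))
    ≡⟨ cong (f • g +_) (sym (*-distribˡ-sum t (λ i → f i * h i))) ⟩
  f • g + t * (f • h) ∎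

unit-• : (i : Fin n) (f : Fin n → ℚ) → unit i • f ≡ f i
unit-• i f = begin
  unit i • f      ≡⟨ sum-single _ i (λ j j≢i → trans (cong (_* f j) (unit-≢ (j≢i ∘ sym))) (*-zeroˡ (f j))) ⟩
  unit i i * f i  ≡⟨ cong (_* f i) (unit-≡ i) ⟩
  1ℚ * f i        ≡⟨ *-identityˡ (f i) ⟩
  f i             ∎

-- Unfolds to the vector local to `resistance`, so `resistance G a b` is by computation
-- `δ a b • (K ▹ δ a b)` with `K` the pseudoinverse of the Laplacian.
δ : (i j : Fin n) → Fin n → ℚ
δ i j k = unit i k - unit j k

δ-• : (i j : Fin n) (f : Fin n → ℚ) → δ i j • f ≡ f i - f j
δ-• i j f = begin
  δ i j • f
    ≡⟨ sum-cong-≗ (λ k → solve 3 (λ a b c → (a :- b) :* c := a :* c :- b :* c) refl (unit i k) (unit j k) (f k)) ⟩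
  sum (λ k → unit i k * f k - unit j k * f k)
    ≡⟨ ∑-distrib-sub (λ k → unit i k * f k) (λ k → unit j k * f k) ⟩
  unit i • f - unit j • f
    ≡⟨ cong₂ _-_ (unit-• i f) (unit-• j f) ⟩
  f i - f j ∎

•-δ : (f : Fin n → ℚ) (i j : Fin n) → f • δ i j ≡ f i - f j
•-δ f i j = trans (•-comm f (δ i j)) (δ-• i j f)

⊗-▹ : (A : Matrix l m) (B : Matrix m n) (f : Fin n → ℚ) → (A ⊗ B) ▹ f ≗ A ▹ (B ▹ f)
⊗-▹ {m = m} {n} A B f i = begin
  ∑[ k < n ] ((A ⊗ B) i k * f k)
    ≡⟨ sum-cong-≗ (λ k → *-distribʳ-sum (f k) (λ j → A i j * B j k)) ⟩
  ∑[ k < n ] ∑[ j < m ] (A i j * B j k * f k)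
    ≡⟨ ∑-comm (λ k j → A i j * B j k * f k) ⟩
  ∑[ j < m ] ∑[ k < n ] (A i j * B j k * f k)
    ≡⟨ sum-cong-≗ (λ j → trans (sum-cong-≗ λ k → *-assoc (A i j) (B j k) (f k))
                               (sym (*-distribˡ-sum (A i j) (λ k → B j k * f k)))) ⟩
  (A ▹ (B ▹ f)) i ∎

adjoint : {A : Matrix n n} → Symmetric A → (f g : Fin n → ℚ) → f • (A ▹ g) ≡ (A ▹ f) • g
adjoint {n} {A} A-sym f g = begin
  ∑[ i < n ] (f i * (A ▹ g) i)
    ≡⟨ sum-cong-≗ (λ i → *-distribˡ-sum (f i) (λ j → A i j * g j)) ⟩
  ∑[ i < n ] ∑[ j < n ] (f i * (A i j * g j))
    ≡⟨ ∑-comm (λ i j → f i * (A i j * g j)) ⟩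
  ∑[ j < n ] ∑[ i < n ] (f i * (A i j * g j))
    ≡⟨ sum-cong-≗ (λ j → sum-cong-≗ λ i →
         trans (solve 3 (λ a b c → a :* (b :* c) := b :* a :* c) refl (f i) (A i j) (g j))
               (cong (λ a → a * f i * g j) (A-sym i j))) ⟩
  ∑[ j < n ] ∑[ i < n ] (A j i * f i * g j)
    ≡⟨ sum-cong-≗ (λ j → sym (*-distribʳ-sum (g j) (λ i → A j i * f i))) ⟩
  (A ▹ f) • g ∎

-- Laplacian, energy, potentials and resistance of a graph.

module _ (G : Graph n) where
  open Graph G

  private
    L : Matrix n n
    L = laplacian G

    A : Matrix n n
    A = adjacency G

  adjacency-yes : ∀ {u v} → u ~ v → A u v ≡ 1ℚ
  adjacency-yes {u} {v} u~v = cong (if_then 1ℚ else 0ℚ) (dec-true (u ~? v) u~v)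

  adjacency-no : ∀ {u v} → ¬ u ~ v → A u v ≡ 0ℚ
  adjacency-no {u} {v} u≁v = cong (if_then 1ℚ else 0ℚ) (dec-false (u ~? v) u≁v)

  adjacency-sym : Symmetric A
  adjacency-sym u v with u ~? v
  ... | yes u~v = sym (adjacency-yes (~-sym u~v))
  ... | no  u≁v = sym (adjacency-no (u≁v ∘ ~-sym))

  adjacency-nonneg : ∀ u v → 0ℚ ≤ A u v
  adjacency-nonneg u v with u ~? v
  ... | yes _ = nonNegative⁻¹ 1ℚ
  ... | no  _ = ≤-refl

  laplacian-sym : Symmetric L
  laplacian-sym u v = cong₂ _-_ diagonal (adjacency-sym u v) where
    diagonal : (if does (u Fin.≟ v) then degree G u else 0ℚ) ≡ (if does (v Fin.≟ u) then degree G v else 0ℚ)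
    diagonal with u Fin.≟ v
    ... | yes refl = sym (cong (if_then degree G u else 0ℚ) (dec-true (u Fin.≟ u) refl))
    ... | no  u≢v  = sym (cong (if_then degree G v else 0ℚ) (dec-false (v Fin.≟ u) (u≢v ∘ sym)))

  -- The diagonal entry is a row sum of the adjacency matrix, so one copy of `f u` goes to each
  -- neighbour. In this edge-by-edge form the Laplacian can be split among petals.
  laplacian-▹ : ∀ f u → (L ▹ f) u ≡ ∑[ v < n ] (A u v * (f u - f v))
  laplacian-▹ f u = begin
    ∑[ v < n ] (L u v * f v)
      ≡⟨ sum-cong-≗ summand ⟩
    ∑[ v < n ] (degree G u * (unit u v * f v) - A u v * f v)
      ≡⟨ ∑-distrib-sub (λ v → degree G u * (unit u v * f v)) (λ v → A u v * f v) ⟩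
    ∑[ v < n ] (degree G u * (unit u v * f v)) - A u • f
      ≡⟨ cong (_- A u • f) (trans (sym (*-distribˡ-sum (degree G u) (λ v → unit u v * f v)))
                                  (cong (degree G u *_) (unit-• u f))) ⟩
    degree G u * f u - A u • f
      ≡⟨ cong (_- A u • f) (*-distribʳ-sum (f u) (A u)) ⟩
    ∑[ v < n ] (A u v * f u) - A u • f
      ≡⟨ sym (∑-distrib-sub (λ v → A u v * f u) (λ v → A u v * f v)) ⟩
    ∑[ v < n ] (A u v * f u - A u v * f v)
      ≡⟨ sum-cong-≗ (λ v → solve 3 (λ a b c → a :* b :- a :* c := a :* (b :- c)) refl (A u v) (f u) (f v)) ⟩
    ∑[ v < n ] (A u v * (f u - f v)) ∎
    where
    summand : ∀ v → L u v * f v ≡ degree G u * (unit u v * f v) - A u v * f v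
    summand v with does (u Fin.≟ v)
    ... | true  = solve 3 (λ d a z → (d :- a) :* z := d :* (con 1ℚ :* z) :- a :* z) refl (degree G u) (A u v) (f v)
    ... | false = solve 3 (λ d a z → (con 0ℚ :- a) :* z := d :* (con 0ℚ :* z) :- a :* z) refl (degree G u) (A u v) (f v)

  laplacian-constant : ∀ f → (∀ u v → f u ≡ f v) → ∀ u → (L ▹ f) u ≡ 0ℚ
  laplacian-constant f const-f u = trans (laplacian-▹ f u) (sum-≡0 λ v →
    trans (cong (λ z → A u v * (z - f v)) (const-f u v))
          (solve 2 (λ a z → a :* (z :- z) := con 0ℚ) refl (A u v) (f v)))

  sum-laplacian : ∀ f → sum (L ▹ f) ≡ 0ℚ
  sum-laplacian f = begin
    sum (L ▹ f)           ≡⟨ sum-cong-≗ (λ u → sym (*-identityˡ ((L ▹ f) u))) ⟩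
    const 1ℚ • (L ▹ f)    ≡⟨ adjoint laplacian-sym (const 1ℚ) f ⟩
    (L ▹ const 1ℚ) • f    ≡⟨ sum-≡0 (λ u → trans (cong (_* f u) (laplacian-constant (const 1ℚ) (λ _ _ → refl) u)) (*-zeroˡ (f u))) ⟩
    0ℚ                    ∎

  -- The Dirichlet form. In the second copy of `f • (L ▹ f)` the order of summation is exchanged,
  -- and symmetry of the adjacency matrix then joins the two terms of each pair `u`, `v` into a
  -- square.
  energy : ∀ f → f • (L ▹ f) + f • (L ▹ f) ≡ ∑[ u < n ] ∑[ v < n ] (A u v * (f u - f v) ²)
  energy f = begin
    f • (L ▹ f) + f • (L ▹ f)
      ≡⟨ cong₂ _+_ expand (trans expand (∑-comm (λ u v → f u * (A u v * (f u - f v))))) ⟩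
    ∑[ u < n ] ∑[ v < n ] (f u * (A u v * (f u - f v))) + ∑[ u < n ] ∑[ v < n ] (f v * (A v u * (f v - f u)))
      ≡⟨ sym (∑-distrib-+ (λ u → ∑[ v < n ] (f u * (A u v * (f u - f v)))) (λ u → ∑[ v < n ] (f v * (A v u * (f v - f u))))) ⟩
    ∑[ u < n ] (∑[ v < n ] (f u * (A u v * (f u - f v))) + ∑[ v < n ] (f v * (A v u * (f v - f u))))
      ≡⟨ sum-cong-≗ (λ u → sym (∑-distrib-+ (λ v → f u * (A u v * (f u - f v))) (λ v → f v * (A v u * (f v - f u))))) ⟩
    ∑[ u < n ] ∑[ v < n ] (f u * (A u v * (f u - f v)) + f v * (A v u * (f v - f u)))
      ≡⟨ sum-cong-≗ (λ u → sum-cong-≗ λ v → trans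
           (cong (λ a → f u * (A u v * (f u - f v)) + f v * (a * (f v - f u))) (adjacency-sym v u))
           (solve 3 (λ a p q → p :* (a :* (p :- q)) :+ q :* (a :* (q :- p)) := a :* ((p :- q) :* (p :- q))) refl
              (A u v) (f u) (f v))) ⟩
    ∑[ u < n ] ∑[ v < n ] (A u v * (f u - f v) ²) ∎
    where
    expand : f • (L ▹ f) ≡ ∑[ u < n ] ∑[ v < n ] (f u * (A u v * (f u - f v)))
    expand = sum-cong-≗ λ u → trans (cong (f u *_) (laplacian-▹ f u))
      (*-distribˡ-sum (f u) (λ v → A u v * (f u - f v)))

  -- A vanishing sum of nonnegative terms has vanishing terms, so `f` agrees at the ends of every
  -- edge, hence along every path.
  energy≡0⇒constant : Connected G → ∀ f → f • (L ▹ f) ≡ 0ℚ → ∀ u v → f u ≡ f v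
  energy≡0⇒constant connected f E≡0 u v = along (connected u v) where
    term-nonneg : ∀ u v → 0ℚ ≤ A u v * (f u - f v) ²
    term-nonneg u v = nonNegative⁻¹ _ {{nonNeg*nonNeg⇒nonNeg (A u v) {{nonNegative (adjacency-nonneg u v)}}
      ((f u - f v) ²) {{nonNegative (²-nonneg (f u - f v))}}}}
    term≡0 : ∀ u v → A u v * (f u - f v) ² ≡ 0ℚ
    term≡0 u = sum-nonneg-≡0 _ (term-nonneg u)
      (sum-nonneg-≡0 _ (λ u → sum-nonneg _ (term-nonneg u)) (trans (sym (energy f)) (cong₂ _+_ E≡0 E≡0)) u)
    edge : ∀ {u v} → u ~ v → f u ≡ f v
    edge {u} {v} u~v = p-q≡0⇒p≡q (f u) (f v) (²≡0⇒≡0 (f u - f v)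
      (trans (sym (*-identityˡ ((f u - f v) ²)))
        (trans (cong (_* (f u - f v) ²) (sym (adjacency-yes u~v))) (term≡0 u v))))
    along : ∀ {u v} → Star _~_ u v → f u ≡ f v
    along ε          = refl
    along (u~v ◅ vs) = trans (edge u~v) (along vs)

  private
    K : Matrix n n
    K = pseudoinverse L

    open IsMoorePenrose (proj₂ (moorePenrose L))

  -- Putting `L ▹ φ` for `δ a b` on both sides of `K` produces `L K L` between two copies of `φ`,
  -- and the first Penrose condition reduces it to `L`. For `flower` the hypothesis is met by the
  -- glued potential.
  resistance-from-potential : ∀ {a b} φ → L ▹ φ ≗ δ a b → resistance G a b ≡ φ a - φ b
  resistance-from-potential {a} {b} φ Lφ≗δ = begin
    δ a b • (K ▹ δ a b)
      ≡⟨ •-congˡ (K ▹ δ a b) (sym ∘ Lφ≗δ) ⟩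
    (L ▹ φ) • (K ▹ δ a b)
      ≡⟨ •-congʳ (L ▹ φ) (λ i → •-congʳ (K i) (sym ∘ Lφ≗δ)) ⟩
    (L ▹ φ) • (K ▹ (L ▹ φ))
      ≡⟨ sym (adjoint laplacian-sym φ (K ▹ (L ▹ φ))) ⟩
    φ • (L ▹ (K ▹ (L ▹ φ)))
      ≡⟨ •-congʳ φ (λ i → trans (sym (⊗-▹ L K (L ▹ φ) i)) (trans (sym (⊗-▹ (L ⊗ K) L φ i)) (•-congˡ φ (APA≈A i)))) ⟩
    φ • (L ▹ φ)
      ≡⟨ trans (•-congʳ φ Lφ≗δ) (•-comm φ (δ a b)) ⟩
    δ a b • φ
      ≡⟨ δ-• a b φ ⟩
    φ a - φ b ∎

  -- The potential of a unit current entering at `a` and leaving at `b`; `laplacian-potential`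
  -- justifies the name for connected graphs.
  potential : (a b : Fin n) → Fin n → ℚ
  potential a b = K ▹ δ a b

  resistance-potential : ∀ a b → resistance G a b ≡ potential a b a - potential a b b
  resistance-potential a b = δ-• a b (potential a b)

  module _ (connected : Connected G) where

    -- The residual `w` of `g` after projection by `L ⊗ K` is killed by `L`, so it has zero energy
    -- and is constant. Its entries sum to zero, since those of `g` and of any `L ▹ f` do; hence `w`
    -- vanishes.
    poisson : ∀ g → sum g ≡ 0ℚ → L ▹ (K ▹ g) ≗ g
    poisson g ∑g≡0 u = sym (p-q≡0⇒p≡q (g u) ((L ▹ (K ▹ g)) u) w≡0) where
      w : Fin n → ℚ
      w u = g u - (L ▹ (K ▹ g)) u
      w′ : w ≗ λ u → g u + (- 1ℚ) * (L ▹ (K ▹ g)) u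
      w′ u = solve 2 (λ a b → a :- b := a :+ (:- con 1ℚ) :* b) refl (g u) ((L ▹ (K ▹ g)) u)
      -- The transpose of `L K L = L`, using that `L` and `L ⊗ K` are symmetric.
      LLK≈L : L ⊗ (L ⊗ K) ≈ L
      LLK≈L i j = begin
        ∑[ k < n ] (L i k * (L ⊗ K) k j)
          ≡⟨ sum-cong-≗ (λ k → trans (cong₂ _*_ (laplacian-sym i k) (AP-sym k j)) (*-comm (L k i) ((L ⊗ K) j k))) ⟩
        (L ⊗ K ⊗ L) j i   ≡⟨ APA≈A j i ⟩
        L j i             ≡⟨ laplacian-sym j i ⟩
        L i j             ∎
      Lw≡0 : ∀ u → (L ▹ w) u ≡ 0ℚ
      Lw≡0 u = begin
        (L ▹ w) u
          ≡⟨ trans (•-congʳ (L u) w′) (•-linʳ (L u) g (L ▹ (K ▹ g)) (- 1ℚ)) ⟩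
        (L ▹ g) u + (- 1ℚ) * (L ▹ (L ▹ (K ▹ g))) u
          ≡⟨ cong (λ z → (L ▹ g) u + (- 1ℚ) * z) (begin
               (L ▹ (L ▹ (K ▹ g))) u    ≡⟨ •-congʳ (L u) (sym ∘ ⊗-▹ L K g) ⟩
               (L ▹ ((L ⊗ K) ▹ g)) u    ≡⟨ sym (⊗-▹ L (L ⊗ K) g u) ⟩
               ((L ⊗ (L ⊗ K)) ▹ g) u    ≡⟨ •-congˡ g (LLK≈L u) ⟩
               (L ▹ g) u                ∎) ⟩
        (L ▹ g) u + (- 1ℚ) * (L ▹ g) u
          ≡⟨ solve 1 (λ a → a :+ (:- con 1ℚ) :* a := con 0ℚ) refl ((L ▹ g) u) ⟩
        0ℚ ∎
      w-constant : ∀ u v → w u ≡ w v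
      w-constant = energy≡0⇒constant connected w
        (sum-≡0 λ u → trans (cong (w u *_) (Lw≡0 u)) (*-zeroʳ (w u)))
      w≡0 : w u ≡ 0ℚ
      w≡0 = *-cancel-0 (fromℕ n) (fromℕ≢0 n {{Fin.nonZeroIndex u}}) (begin
        fromℕ n * w u                     ≡⟨ sym (sum-const n (w u)) ⟩
        sum {n} (const (w u))             ≡⟨ sum-cong-≗ (w-constant u) ⟩
        sum w                             ≡⟨ ∑-distrib-sub g (L ▹ (K ▹ g)) ⟩
        sum g - sum (L ▹ (K ▹ g))         ≡⟨ cong₂ _-_ ∑g≡0 (sum-laplacian (K ▹ g)) ⟩
        0ℚ                                ∎)

    laplacian-potential : ∀ a b → L ▹ potential a b ≗ δ a b
    laplacian-potential a b = poisson (δ a b) (begin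
      sum (δ a b)          ≡⟨ sum-cong-≗ (λ k → sym (*-identityʳ (δ a b k))) ⟩
      δ a b • const 1ℚ     ≡⟨ δ-• a b (const 1ℚ) ⟩
      0ℚ                   ∎)

    -- Each side pairs one potential with the Laplacian of the other, and `L` is self-adjoint. This
    -- takes the place of symmetry of `K`.
    reciprocity : ∀ a b c d → potential a b c - potential a b d ≡ potential c d a - potential c d b
    reciprocity a b c d = begin
      potential a b c - potential a b d          ≡⟨ sym (δ-• c d (potential a b)) ⟩
      δ c d • potential a b                      ≡⟨ •-congˡ (potential a b) (sym ∘ laplacian-potential c d) ⟩
      (L ▹ potential c d) • potential a b        ≡⟨ sym (adjoint laplacian-sym (potential c d) (potential a b)) ⟩
      potential c d • (L ▹ potential a b)        ≡⟨ •-congʳ (potential c d) (laplacian-potential a b) ⟩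
      potential c d • δ a b                      ≡⟨ •-comm (potential c d) (δ a b) ⟩
      δ a b • potential c d                      ≡⟨ δ-• a b (potential c d) ⟩
      potential c d a - potential c d b          ∎

    -- The resistance is the energy of `potential a b`. Were it zero, the potential would be
    -- constant and its Laplacian zero, but at `a` that Laplacian is 1.
    resistance-≢0 : ∀ {a b} → a ≢ b → resistance G a b ≢ 0ℚ
    resistance-≢0 {a} {b} a≢b r≡0 = contradiction 1≡0 λ () where
      p : Fin n → ℚ
      p = potential a b
      1≡0 : 1ℚ ≡ 0ℚ
      1≡0 = begin
        1ℚ - 0ℚ                ≡⟨ cong₂ _-_ (sym (unit-≡ a)) (sym (unit-≢ (a≢b ∘ sym))) ⟩
        unit a a - unit b a    ≡⟨ sym (laplacian-potential a b a) ⟩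
        (L ▹ p) a              ≡⟨ laplacian-constant p (energy≡0⇒constant connected p
          (trans (•-congʳ p (laplacian-potential a b)) (trans (•-comm p (δ a b)) r≡0))) a ⟩
        0ℚ                     ∎

  private
    potential-K : ∀ a b c → potential a b c ≡ K c a - K c b
    potential-K a b c = trans (•-comm (K c) (δ a b)) (δ-• a b (K c))

    resistance-K : ∀ a b → resistance G a b ≡ (K a a - K a b) - (K b a - K b b)
    resistance-K a b = trans (resistance-potential a b) (cong₂ _-_ (potential-K a b a) (potential-K a b b))

  resistance-sym : ∀ a b → resistance G a b ≡ resistance G b a
  resistance-sym a b = begin
    resistance G a b                           ≡⟨ resistance-K a b ⟩
    (K a a - K a b) - (K b a - K b b)          ≡⟨ solve 4 (λ p q r s → (p :- q) :- (r :- s) := (s :- r) :- (q :- p)) refl (K a a) (K a b) (K b a) (K b b) ⟩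
    (K b b - K b a) - (K a b - K a a)          ≡⟨ sym (resistance-K b a) ⟩
    resistance G b a                           ∎

  resistance-refl : ∀ a → resistance G a a ≡ 0ℚ
  resistance-refl a = trans (resistance-potential a a) (+-inverseʳ (potential a a a))

  -- Rewriting one of the two copies by `reciprocity` makes every off-diagonal entry of `K` appear
  -- in both orders, as it does in the four resistances; the diagonal entries cancel among those.
  polarisation : Connected G → ∀ a b c d → fromℕ 2 * (potential a b c - potential a b d) ≡
    resistance G c b + resistance G d a - resistance G c a - resistance G d b
  polarisation connected a b c d = begin
    fromℕ 2 * (potential a b c - potential a b d)
      ≡⟨ solve 1 (λ z → con (fromℕ 2) :* z := z :+ z) refl (potential a b c - potential a b d) ⟩
    (potential a b c - potential a b d) + (potential a b c - potential a b d)
      ≡⟨ cong ((potential a b c - potential a b d) +_) (reciprocity connected a b c d) ⟩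
    (potential a b c - potential a b d) + (potential c d a - potential c d b)
      ≡⟨ cong₂ _+_ (cong₂ _-_ (potential-K a b c) (potential-K a b d)) (cong₂ _-_ (potential-K c d a) (potential-K c d b)) ⟩
    ((K c a - K c b) - (K d a - K d b)) + ((K a c - K a d) - (K b c - K b d))
      ≡⟨ solve 12 (λ aa bb cc dd ca cb da db ac ad bc bd →
           ((ca :- cb) :- (da :- db)) :+ ((ac :- ad) :- (bc :- bd)) :=
           ((cc :- cb) :- (bc :- bb)) :+ ((dd :- da) :- (ad :- aa))
             :- ((cc :- ca) :- (ac :- aa)) :- ((dd :- db) :- (bd :- bb))) refl
           (K a a) (K b b) (K c c) (K d d) (K c a) (K c b) (K d a) (K d b) (K a c) (K a d) (K b c) (K b d) ⟩
    ((K c c - K c b) - (K b c - K b b)) + ((K d d - K d a) - (K a d - K a a))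
      - ((K c c - K c a) - (K a c - K a a)) - ((K d d - K d b) - (K b d - K b b))
      ≡⟨ sym (cong₂ _-_ (cong₂ _-_ (cong₂ _+_ (resistance-K c b) (resistance-K d a)) (resistance-K c a)) (resistance-K d b)) ⟩
    resistance G c b + resistance G d a - resistance G c a - resistance G d b ∎

-- Cyclic order of the petals, and the Laplacian of the flower.

module Petals {m} (G : Graph (suc m)) {x y : Fin (suc m)} (x≢y : x ≢ y) (n : ℕ) (3≤n : 3 ℕ.≤ n) where
  open Graph G
  open Flower G x≢y n 3≤n

  private instance
    n≢0 : ℕ.NonZero n
    n≢0 = ℕ.>-nonZero (ℕ.≤-trans (ℕ.s≤s ℕ.z≤n) 3≤n)

  private
    %-absorbˡ : ∀ a b → (a % n ℕ.+ b) % n ≡ (a ℕ.+ b) % n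
    %-absorbˡ a b = trans (%-distribˡ-+ (a % n) b n)
      (trans (cong (λ z → (z ℕ.+ b % n) % n) (m%n%n≡m%n a n)) (sym (%-distribˡ-+ a b n)))

    %-absorbʳ : ∀ a b → (a ℕ.+ b % n) % n ≡ (a ℕ.+ b) % n
    %-absorbʳ a b = trans (cong (_% n) (ℕ.+-comm a (b % n)))
      (trans (%-absorbˡ b a) (cong (_% n) (ℕ.+-comm b a)))

  toℕ-rotate : ∀ i k → toℕ (rotate i k) ≡ (toℕ i ℕ.+ k) % n
  toℕ-rotate i k = Fin.toℕ-fromℕ< _

  toℕ-% : (i : Fin n) → toℕ i % n ≡ toℕ i
  toℕ-% i = m<n⇒m%n≡m (Fin.toℕ<n i)

  rotate-0 : ∀ i → rotate i 0 ≡ i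
  rotate-0 i = Fin.toℕ-injective (begin
    toℕ (rotate i 0)     ≡⟨ toℕ-rotate i 0 ⟩
    (toℕ i ℕ.+ 0) % n    ≡⟨ cong (_% n) (ℕ.+-identityʳ (toℕ i)) ⟩
    toℕ i % n            ≡⟨ toℕ-% i ⟩
    toℕ i                ∎)

  rotate-n : ∀ i → rotate i n ≡ i
  rotate-n i = Fin.toℕ-injective (trans (toℕ-rotate i n) (trans ([m+n]%n≡m%n (toℕ i) n) (toℕ-% i)))

  rotate-+ : ∀ i j k → rotate (rotate i j) k ≡ rotate i (j ℕ.+ k)
  rotate-+ i j k = Fin.toℕ-injective (begin
    toℕ (rotate (rotate i j) k)        ≡⟨ toℕ-rotate (rotate i j) k ⟩
    (toℕ (rotate i j) ℕ.+ k) % n       ≡⟨ cong (λ z → (z ℕ.+ k) % n) (toℕ-rotate i j) ⟩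
    ((toℕ i ℕ.+ j) % n ℕ.+ k) % n      ≡⟨ %-absorbˡ (toℕ i ℕ.+ j) k ⟩
    (toℕ i ℕ.+ j ℕ.+ k) % n            ≡⟨ cong (_% n) (ℕ.+-assoc (toℕ i) j k) ⟩
    (toℕ i ℕ.+ (j ℕ.+ k)) % n          ≡⟨ sym (toℕ-rotate i (j ℕ.+ k)) ⟩
    toℕ (rotate i (j ℕ.+ k))           ∎)

  rotate-injective : ∀ {i j} → rotate i 1 ≡ rotate j 1 → i ≡ j
  rotate-injective {i} {j} eq = trans (sym (back i)) (trans (cong (λ z → rotate z (n ∸ 1)) eq) (back j)) where
    -- A full turn is the identity, so `n ∸ 1` further steps undo one.
    back : ∀ i → rotate (rotate i 1) (n ∸ 1) ≡ i
    back i = trans (rotate-+ i 1 (n ∸ 1)) (trans (cong (rotate i) (ℕ.suc-pred n)) (rotate-n i))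

  -- The number of forward steps from petal `i` to petal `j`, that is `j − i` modulo `n`;
  -- subtracting `toℕ i` from `n` keeps `∸` from truncating.
  offset : Fin n → Fin n → ℕ
  offset i j = (toℕ j ℕ.+ (n ∸ toℕ i)) % n

  offset<n : ∀ i j → offset i j ℕ.< n
  offset<n i j = m%n<n (toℕ j ℕ.+ (n ∸ toℕ i)) n

  private
    around : ∀ (i : Fin n) k → (toℕ i ℕ.+ (k ℕ.+ (n ∸ toℕ i))) % n ≡ k % n
    around i k = begin
      (toℕ i ℕ.+ (k ℕ.+ (n ∸ toℕ i))) % n    ≡⟨ cong (_% n) (sym (ℕ.+-assoc (toℕ i) k (n ∸ toℕ i))) ⟩
      (toℕ i ℕ.+ k ℕ.+ (n ∸ toℕ i)) % n      ≡⟨ cong (λ z → (z ℕ.+ (n ∸ toℕ i)) % n) (ℕ.+-comm (toℕ i) k) ⟩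
      (k ℕ.+ toℕ i ℕ.+ (n ∸ toℕ i)) % n      ≡⟨ cong (_% n) (ℕ.+-assoc k (toℕ i) (n ∸ toℕ i)) ⟩
      (k ℕ.+ (toℕ i ℕ.+ (n ∸ toℕ i))) % n    ≡⟨ cong (λ z → (k ℕ.+ z) % n) (ℕ.m+[n∸m]≡n (ℕ.<⇒≤ (Fin.toℕ<n i))) ⟩
      (k ℕ.+ n) % n                          ≡⟨ [m+n]%n≡m%n k n ⟩
      k % n                                  ∎

  rotate-offset : ∀ i j → rotate i (offset i j) ≡ j
  rotate-offset i j = Fin.toℕ-injective (begin
    toℕ (rotate i (offset i j))                 ≡⟨ toℕ-rotate i (offset i j) ⟩
    (toℕ i ℕ.+ offset i j) % n                  ≡⟨ %-absorbʳ (toℕ i) (toℕ j ℕ.+ (n ∸ toℕ i)) ⟩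
    (toℕ i ℕ.+ (toℕ j ℕ.+ (n ∸ toℕ i))) % n     ≡⟨ around i (toℕ j) ⟩
    toℕ j % n                                   ≡⟨ toℕ-% j ⟩
    toℕ j                                       ∎)

  offset-rotate : ∀ i k → offset i (rotate i k) ≡ k % n
  offset-rotate i k = begin
    (toℕ (rotate i k) ℕ.+ (n ∸ toℕ i)) % n      ≡⟨ cong (λ z → (z ℕ.+ (n ∸ toℕ i)) % n) (toℕ-rotate i k) ⟩
    ((toℕ i ℕ.+ k) % n ℕ.+ (n ∸ toℕ i)) % n     ≡⟨ %-absorbˡ (toℕ i ℕ.+ k) (n ∸ toℕ i) ⟩
    (toℕ i ℕ.+ k ℕ.+ (n ∸ toℕ i)) % n           ≡⟨ cong (_% n) (ℕ.+-assoc (toℕ i) k (n ∸ toℕ i)) ⟩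
    (toℕ i ℕ.+ (k ℕ.+ (n ∸ toℕ i))) % n         ≡⟨ around i k ⟩
    k % n                                       ∎

  offset-rotate-< : ∀ i {k} → k ℕ.< n → offset i (rotate i k) ≡ k
  offset-rotate-< i {k} k<n = trans (offset-rotate i k) (m<n⇒m%n≡m k<n)

  offset-step : ∀ i j → offset i (rotate j 1) ≡ suc (offset i j) % n
  offset-step i j = begin
    offset i (rotate j 1)                          ≡⟨ cong (λ j → offset i (rotate j 1)) (sym (rotate-offset i j)) ⟩
    offset i (rotate (rotate i (offset i j)) 1)    ≡⟨ cong (offset i) (rotate-+ i (offset i j) 1) ⟩
    offset i (rotate i (offset i j ℕ.+ 1))         ≡⟨ offset-rotate i (offset i j ℕ.+ 1) ⟩
    (offset i j ℕ.+ 1) % n                         ≡⟨ cong (_% n) (ℕ.+-comm (offset i j) 1) ⟩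
    suc (offset i j) % n                           ∎

  rotation : Fin n → Permutation n n
  rotation i = permutation (rotate i ∘ toℕ) (λ j → fromℕ< (offset<n i j))
    (λ j → trans (cong (rotate i) (Fin.toℕ-fromℕ< (offset<n i j))) (rotate-offset i j))
    (λ k → Fin.toℕ-injective (trans (Fin.toℕ-fromℕ< (offset<n i (rotate i (toℕ k)))) (offset-rotate-< i (Fin.toℕ<n k))))

  sum-rotate : ∀ i (f : Fin n → ℚ) → sum f ≡ ∑[ k < n ] f (rotate i (toℕ k))
  sum-rotate i f = sum-permute f (rotation i)

  -- `3≤n` says `2 < n`, so the petal two steps ahead has offset 2 and differs from `i`, whose
  -- offset is 0.
  rotate-no-2-cycle : ∀ {i j} → j ≡ rotate i 1 → i ≢ rotate j 1
  rotate-no-2-cycle {i} refl i≡ = contradiction 2≡0 λ () where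
    2≡0 : 2 ≡ 0
    2≡0 = begin
      2                         ≡⟨ sym (offset-rotate-< i 3≤n) ⟩
      offset i (rotate i 2)     ≡⟨ cong (offset i) (sym (trans i≡ (rotate-+ i 1 1))) ⟩
      offset i i                ≡⟨ cong (offset i) (sym (rotate-0 i)) ⟩
      offset i (rotate i 0)     ≡⟨ offset-rotate-< i (ℕ.>-nonZero⁻¹ n) ⟩
      0                         ∎

  petal-y : ∀ i → petal i y ≡ petal (rotate i 1) x
  petal-y i with y Fin.≟ y | y Fin.≟ x
  ... | no  y≢y | _       = contradiction refl y≢y
  ... | yes _   | yes y≡x = contradiction (sym y≡x) x≢y
  ... | yes _   | no  _   = cong (combine (rotate i 1)) (Fin.punchOut-cong y refl)

  -- Only a copy of `y` is stored one petal ahead, so comparing the petal components of the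
  -- `combine` codes decides the case.
  petal-≡ : ∀ i j u v → petal i u ≡ petal j v →
            i ≡ j ⊎ (u ≡ y × j ≡ rotate i 1) ⊎ (v ≡ y × i ≡ rotate j 1)
  petal-≡ i j u v eq with y Fin.≟ u | y Fin.≟ v
  ... | yes _   | yes _   = inj₁ (rotate-injective (Fin.combine-injectiveˡ _ _ _ _ eq))
  ... | yes y≡u | no  _   = inj₂ (inj₁ (sym y≡u , sym (Fin.combine-injectiveˡ _ _ _ _ eq)))
  ... | no  _   | yes y≡v = inj₂ (inj₂ (sym y≡v , Fin.combine-injectiveˡ _ _ _ _ eq))
  ... | no  _   | no  _   = inj₁ (Fin.combine-injectiveˡ _ _ _ _ eq)

  -- Different petals share a vertex only where one follows the other. Two shared vertices would
  -- both be the copy of `y` in the same petal, or each petal would follow the other. Hence an edge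
  -- of the flower determines its petal.
  common-petal : ∀ {i j u v u′ v′} → u ≢ v → u′ ≢ v′ →
                 petal i u ≡ petal j u′ → petal i v ≡ petal j v′ → i ≡ j
  common-petal {i} {j} {u} {v} {u′} {v′} u≢v u′≢v′ eqᵤ eqᵥ
    with petal-≡ i j u u′ eqᵤ | petal-≡ i j v v′ eqᵥ
  ... | inj₁ i≡j | _ = i≡j
  ... | inj₂ _   | inj₁ i≡j = i≡j
  ... | inj₂ (inj₁ (u≡y , _)) | inj₂ (inj₁ (v≡y , _)) = contradiction (trans u≡y (sym v≡y)) u≢v
  ... | inj₂ (inj₁ (_ , j≡))  | inj₂ (inj₂ (_ , i≡))  = contradiction i≡ (rotate-no-2-cycle j≡)
  ... | inj₂ (inj₂ (_ , i≡))  | inj₂ (inj₁ (_ , j≡))  = contradiction i≡ (rotate-no-2-cycle j≡)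
  ... | inj₂ (inj₂ (u′≡y , _)) | inj₂ (inj₂ (v′≡y , _)) = contradiction (trans u′≡y (sym v′≡y)) u′≢v′

  private
    A : Matrix (suc m) (suc m)
    A = adjacency G

    ~⇒≢ : ∀ {u v} → u ~ v → u ≢ v
    ~⇒≢ u~u refl = ~-irrefl u~u

  -- The triple sum counts the lifts of the pair `a`, `b` to an edge of a petal. There is at most
  -- one, so the count is the 0/1 adjacency entry.
  adjacency-flower : ∀ a b → adjacency flower a b ≡
    ∑[ i < n ] ∑[ u < suc m ] ∑[ v < suc m ] (A u v * (unit (petal i u) a * unit (petal i v) b))
  adjacency-flower a b = go (Graph._~?_ flower a b) where
    term : Fin n → Fin (suc m) → Fin (suc m) → ℚ
    term i u v = A u v * (unit (petal i u) a * unit (petal i v) b)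
    term≡0 : ∀ i u v → ¬ (u ~ v × petal i u ≡ a × petal i v ≡ b) → term i u v ≡ 0ℚ
    term≡0 i u v ¬edge with u ~? v | petal i u Fin.≟ a | petal i v Fin.≟ b
    ... | no _    | pᵤ | pᵥ = *-zeroˡ ((if does pᵤ then 1ℚ else 0ℚ) * (if does pᵥ then 1ℚ else 0ℚ))
    ... | yes _   | no _   | pᵥ = trans (cong (1ℚ *_) (*-zeroˡ (if does pᵥ then 1ℚ else 0ℚ))) (*-zeroʳ 1ℚ)
    ... | yes _   | yes _  | no _ = refl
    ... | yes u~v | yes pᵤ | yes pᵥ = contradiction (u~v , pᵤ , pᵥ) ¬edge
    go : Dec (Graph._~_ flower a b) → adjacency flower a b ≡ ∑[ i < n ] ∑[ u < suc m ] ∑[ v < suc m ] term i u v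
    go (no  a≁b) = trans (adjacency-no flower a≁b) (sym (sum-≡0 λ i → sum-≡0 λ u → sum-≡0 λ v →
      term≡0 i u v λ edge → a≁b (i , u , v , edge)))
    -- The sums collapse from the inside: `petal-injective` fixes `v` and then `u`, and
    -- `common-petal` fixes `i`.
    go (yes a~b@(i , u , v , u~v , refl , refl)) = begin
      adjacency flower a b                           ≡⟨ adjacency-yes flower a~b ⟩
      1ℚ                                             ≡⟨ sym (cong₂ _*_ (adjacency-yes G u~v) (cong₂ _*_ (unit-≡ a) (unit-≡ b))) ⟩
      term i u v                                     ≡⟨ sym (sum-single (term i u) v only-v) ⟩
      sum (term i u)                                 ≡⟨ sym (sum-single (λ u → sum (term i u)) u only-u) ⟩
      ∑[ u < suc m ] sum (term i u)                  ≡⟨ sym (sum-single (λ i → ∑[ u < suc m ] sum (term i u)) i only-i) ⟩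
      ∑[ i < n ] ∑[ u < suc m ] sum (term i u)       ∎
      where
      only-v : ∀ v′ → v′ ≢ v → term i u v′ ≡ 0ℚ
      only-v v′ v′≢v = term≡0 i u v′ λ (_ , _ , eq) → v′≢v (petal-injective i eq)
      only-u : ∀ u′ → u′ ≢ u → sum (term i u′) ≡ 0ℚ
      only-u u′ u′≢u = sum-≡0 λ v′ → term≡0 i u′ v′ λ (_ , eq , _) → u′≢u (petal-injective i eq)
      only-i : ∀ i′ → i′ ≢ i → ∑[ u < suc m ] sum (term i′ u) ≡ 0ℚ
      only-i i′ i′≢i = sum-≡0 λ u′ → sum-≡0 λ v′ → term≡0 i′ u′ v′ λ (u′~v′ , eqᵤ , eqᵥ) →
        i′≢i (common-petal (~⇒≢ u′~v′) (~⇒≢ u~v) eqᵤ eqᵥ)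

  -- Petals partition the edges, so the current leaving `a` is the sum of the currents leaving its
  -- copies in the separate petals. This reduces the flower to Laplacians of `G`.
  laplacian-flower : ∀ φ a → (laplacian flower ▹ φ) a ≡
    ∑[ i < n ] ((λ u → unit (petal i u) a) • (laplacian G ▹ (φ ∘ petal i)))
  laplacian-flower φ a = begin
    (laplacian flower ▹ φ) a
      ≡⟨ laplacian-▹ flower φ a ⟩
    ∑[ b < n ℕ.* m ] (adjacency flower a b * (φ a - φ b))
      ≡⟨ sum-cong-≗ (λ b → cong (_* (φ a - φ b)) (adjacency-flower a b)) ⟩
    ∑[ b < n ℕ.* m ] (∑[ i < n ] ∑[ u < suc m ] ∑[ v < suc m ] (A u v * (unit (petal i u) a * unit (petal i v) b)) * (φ a - φ b))
      ≡⟨ sum-cong-≗ distribute ⟩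
    ∑[ b < n ℕ.* m ] ∑[ i < n ] ∑[ u < suc m ] ∑[ v < suc m ] T b i u v
      ≡⟨ ∑-comm (λ b i → ∑[ u < suc m ] ∑[ v < suc m ] T b i u v) ⟩
    ∑[ i < n ] ∑[ b < n ℕ.* m ] ∑[ u < suc m ] ∑[ v < suc m ] T b i u v
      ≡⟨ sum-cong-≗ (λ i → trans (∑-comm (λ b u → ∑[ v < suc m ] T b i u v)) (sum-cong-≗ λ u → ∑-comm (λ b v → T b i u v))) ⟩
    ∑[ i < n ] ∑[ u < suc m ] ∑[ v < suc m ] ∑[ b < n ℕ.* m ] T b i u v
      ≡⟨ sum-cong-≗ (λ i → sum-cong-≗ λ u → trans (sum-cong-≗ (inner i u)) (sym (trans
           (cong (unit (petal i u) a *_) (laplacian-▹ G (φ ∘ petal i) u))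
           (*-distribˡ-sum (unit (petal i u) a) (λ v → A u v * (φ (petal i u) - φ (petal i v))))))) ⟩
    ∑[ i < n ] ((λ u → unit (petal i u) a) • (laplacian G ▹ (φ ∘ petal i))) ∎
    where
    T : Fin (n ℕ.* m) → Fin n → Fin (suc m) → Fin (suc m) → ℚ
    T b i u v = A u v * (unit (petal i u) a * unit (petal i v) b) * (φ a - φ b)
    distribute : ∀ b → ∑[ i < n ] ∑[ u < suc m ] ∑[ v < suc m ] (A u v * (unit (petal i u) a * unit (petal i v) b)) * (φ a - φ b)
                     ≡ ∑[ i < n ] ∑[ u < suc m ] ∑[ v < suc m ] T b i u v
    distribute b = trans (*-distribʳ-sum (φ a - φ b) (λ i → ∑[ u < suc m ] sum (t i u))) (sum-cong-≗ λ i →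
      trans (*-distribʳ-sum (φ a - φ b) (λ u → sum (t i u))) (sum-cong-≗ λ u → *-distribʳ-sum (φ a - φ b) (t i u)))
      where
      t : Fin n → Fin (suc m) → Fin (suc m) → ℚ
      t i u v = A u v * (unit (petal i u) a * unit (petal i v) b)
    -- The weight `unit p a` vanishes unless `p` is `a`, so `φ a` may be replaced by the value at
    -- the petal vertex, leaving only `φ ∘ petal i`.
    at-a : ∀ p z → unit p a * (φ a - z) ≡ unit p a * (φ p - z)
    at-a p z with p Fin.≟ a
    ... | yes refl = refl
    ... | no  _    = trans (*-zeroˡ (φ a - z)) (sym (*-zeroˡ (φ p - z)))
    inner : ∀ i u v → ∑[ b < n ℕ.* m ] T b i u v ≡ unit (petal i u) a * (A u v * (φ (petal i u) - φ (petal i v)))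
    inner i u v = begin
      ∑[ b < n ℕ.* m ] T b i u v
        ≡⟨ sum-cong-≗ (λ b → solve 4 (λ c p q d → c :* (p :* q) :* d := (c :* p) :* (q :* d)) refl
             (A u v) (unit (petal i u) a) (unit (petal i v) b) (φ a - φ b)) ⟩
      ∑[ b < n ℕ.* m ] (A u v * unit (petal i u) a * (unit (petal i v) b * (φ a - φ b)))
        ≡⟨ sym (*-distribˡ-sum (A u v * unit (petal i u) a) (λ b → unit (petal i v) b * (φ a - φ b))) ⟩
      A u v * unit (petal i u) a * (unit (petal i v) • (λ b → φ a - φ b))
        ≡⟨ cong (A u v * unit (petal i u) a *_) (unit-• (petal i v) (λ b → φ a - φ b)) ⟩
      A u v * unit (petal i u) a * (φ a - φ (petal i v))
        ≡⟨ *-assoc (A u v) (unit (petal i u) a) (φ a - φ (petal i v)) ⟩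
      A u v * (unit (petal i u) a * (φ a - φ (petal i v)))
        ≡⟨ cong (A u v *_) (at-a (petal i u) (φ (petal i v))) ⟩
      A u v * (unit (petal i u) a * (φ (petal i u) - φ (petal i v)))
        ≡⟨ solve 3 (λ p q r → p :* (q :* r) := q :* (p :* r)) refl (A u v) (unit (petal i u) a) (φ (petal i u) - φ (petal i v)) ⟩
      unit (petal i u) a * (A u v * (φ (petal i u) - φ (petal i v))) ∎

  -- The values `ψ i y` are discarded, because that vertex is stored as `x` of the next petal; the
  -- matching hypothesis of `glue-petal` recovers them.
  glue : (Fin n → Fin (suc m) → ℚ) → Fin (n ℕ.* m) → ℚ
  glue ψ a = uncurry (λ i k → ψ i (punchIn y k)) (remQuot m a)

  glue-petal : ∀ ψ → (∀ i → ψ i y ≡ ψ (rotate i 1) x) → ∀ i v → glue ψ (petal i v) ≡ ψ i v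
  glue-petal ψ match i v with y Fin.≟ v
  ... | yes refl = trans (cong (uncurry λ i k → ψ i (punchIn y k)) (Fin.remQuot-combine (rotate i 1) (punchOut (x≢y ∘ sym))))
                     (trans (cong (ψ (rotate i 1)) (Fin.punchIn-punchOut (x≢y ∘ sym))) (sym (match i)))
  ... | no  y≢v  = trans (cong (uncurry λ i k → ψ i (punchIn y k)) (Fin.remQuot-combine i (punchOut y≢v)))
                     (cong (ψ i) (Fin.punchIn-punchOut y≢v))

-- Routes through the petals and the glued potential.

-- Terminals source k → sink k in the k-th petal whose unit currents add up to one
-- from u in petal 0 to v in petal l. This is phrased as telescoping for every F
-- compatible with the identification of y in petal k with x in petal k + 1, as it is
-- applied to potentials and to currents alike.
record Route (n : ℕ) {m} (x y u v : Fin m) (l : ℕ) : Set where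
  field
    source sink : ℕ → Fin m
    l<n         : l ℕ.< n
    telescope   : ∀ (F : ℕ → Fin m → ℚ) → (∀ k → F k y ≡ F (suc k) x) →
                  ∑[ k < n ] (F (toℕ k) (source (toℕ k)) - F (toℕ k) (sink (toℕ k))) ≡ F 0 u - F l v

  total : (Fin m → Fin m → ℚ) → ℚ
  total f = ∑[ k < n ] f (source (toℕ k)) (sink (toℕ k))

module _ {m} (G : Graph (suc m)) (connected : Connected G) {x y : Fin (suc m)} (x≢y : x ≢ y)
         (n : ℕ) (3≤n : 3 ℕ.≤ n) where
  open Flower G x≢y n 3≤n
  open Petals G x≢y n 3≤n

  private
    instance
      n≢0 : ℕ.NonZero n
      n≢0 = ℕ.>-nonZero (ℕ.≤-trans (ℕ.s≤s ℕ.z≤n) 3≤n)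

    L : Matrix (suc m) (suc m)
    L = laplacian G

    h : Fin (suc m) → ℚ
    h = potential G x y

    R : ℚ
    R = resistance G x y

  -- `closed` is the voltage law around the cycle: the circulation drops `t * R` in each of the `n`
  -- petals, and the route drops the remaining summand in total. The petal `i` is number 0 on the
  -- route.
  module _ {u v : Fin (suc m)} {l : ℕ} (ρ : Route n x y u v l) (t : ℚ)
           (closed : fromℕ n * (t * R) + (h u - h v + fromℕ l * R) ≡ 0ℚ) (i : Fin n) where
    open Route ρ

    private
      D : ℚ
      D = h u - h v + fromℕ l * R

      -- `q k` drives the route through petal `k`, and `g k` adds the circulation. `Φ k` shifts
      -- `g k` to the value `- S k` at `x`, which makes consecutive petals agree where they meet.
      q g Φ : ℕ → Fin (suc m) → ℚ
      drop S : ℕ → ℚ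
      q k = potential G (source k) (sink k)
      g k w = q k w + t * h w
      drop k = g k x - g k y
      S k = ∑[ j < k ] drop (toℕ j)
      Φ k w = g k w - g k x - S k

      Φ-step : ∀ k → Φ k y ≡ Φ (suc k) x
      Φ-step k = begin
        g k y - g k x - S k
          ≡⟨ solve 4 (λ a b s c → a :- b :- s := c :- c :- (s :+ (b :- a))) refl (g k y) (g k x) (S k) (g (suc k) x) ⟩
        g (suc k) x - g (suc k) x - (S k + drop k)
          ≡⟨ cong (λ s → g (suc k) x - g (suc k) x - s) (sym (sum-snoc drop k)) ⟩
        Φ (suc k) x ∎

      -- `reciprocity` converts the drop of `q k` across the petal into the drop of `h` between the
      -- terminals. As `h` is the same in all petals, these drops telescope.
      drop-h : ∀ k → drop k ≡ (h (source k) - h (sink k)) + t * R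
      drop-h k = begin
        (q k x + t * h x) - (q k y + t * h y)
          ≡⟨ solve 5 (λ a b t c d → (a :+ t :* c) :- (b :+ t :* d) := (a :- b) :+ t :* (c :- d)) refl (q k x) (q k y) t (h x) (h y) ⟩
        (q k x - q k y) + t * (h x - h y)
          ≡⟨ cong₂ (λ z w → z + t * w) (reciprocity G connected (source k) (sink k) x y) (sym (resistance-potential G x y)) ⟩
        (h (source k) - h (sink k)) + t * R ∎

      -- `h` alone is not compatible with the identification, since it drops by `R` from `x` to `y`.
      -- Lowering it by `k` times `R` in petal `k` repairs this and cancels between source and sink.
      sum-h : ∑[ k < n ] (h (source (toℕ k)) - h (sink (toℕ k))) ≡ D
      sum-h = begin
        ∑[ k < n ] (h (source (toℕ k)) - h (sink (toℕ k)))
          ≡⟨ sum-cong-≗ {n} (λ k → solve 3 (λ a b c → a :- b := (a :- c) :- (b :- c)) refl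
               (h (source (toℕ k))) (h (sink (toℕ k))) (fromℕ (toℕ k) * R)) ⟩
        ∑[ k < n ] (F (toℕ k) (source (toℕ k)) - F (toℕ k) (sink (toℕ k)))
          ≡⟨ telescope F F-step ⟩
        F 0 u - F l v
          ≡⟨ solve 4 (λ a b c r → (a :- con 0ℚ :* r) :- (b :- c) := a :- b :+ c) refl (h u) (h v) (fromℕ l * R) R ⟩
        D ∎
        where
        F : ℕ → Fin (suc m) → ℚ
        F k w = h w - fromℕ k * R
        F-step : ∀ k → F k y ≡ F (suc k) x
        F-step k = begin
          h y - fromℕ k * R
            ≡⟨ solve 4 (λ a b k r → b :- k :* r := a :- (k :* r :+ (a :- b))) refl (h x) (h y) (fromℕ k) R ⟩
          h x - (fromℕ k * R + (h x - h y))
            ≡⟨ cong (λ z → h x - (fromℕ k * R + z)) (sym (resistance-potential G x y)) ⟩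
          h x - (fromℕ k * R + R)
            ≡⟨ solve 3 (λ a k r → a :- (k :* r :+ r) := a :- (con 1ℚ :+ k) :* r) refl (h x) (fromℕ k) R ⟩
          h x - (1ℚ + fromℕ k) * R
            ≡⟨ cong (λ z → h x - z * R) (sym (fromℕ-suc k)) ⟩
          h x - fromℕ (suc k) * R ∎

      S-closed : S n ≡ 0ℚ
      S-closed = begin
        ∑[ k < n ] drop (toℕ k)
          ≡⟨ sum-cong-≗ {n} (drop-h ∘ toℕ) ⟩
        ∑[ k < n ] ((h (source (toℕ k)) - h (sink (toℕ k))) + t * R)
          ≡⟨ ∑-distrib-+ {n} (λ k → h (source (toℕ k)) - h (sink (toℕ k))) (const (t * R)) ⟩
        ∑[ k < n ] (h (source (toℕ k)) - h (sink (toℕ k))) + sum {n} (const (t * R))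
          ≡⟨ cong₂ _+_ sum-h (sum-const n (t * R)) ⟩
        D + fromℕ n * (t * R)
          ≡⟨ trans (+-comm D (fromℕ n * (t * R))) closed ⟩
        0ℚ ∎

      -- The seam of the cycle: at `k = n` the accumulated drop vanishes by `closed`, so the
      -- potential returns to its initial value.
      Φ-mod : ∀ {k} → k ℕ.≤ n → Φ k x ≡ Φ (k % n) x
      Φ-mod {k} k≤n with ℕ.m≤n⇒m<n∨m≡n k≤n
      ... | inj₁ k<n  = cong (λ k → Φ k x) (sym (m<n⇒m%n≡m k<n))
      ... | inj₂ refl = begin
        g n x - g n x - S n    ≡⟨ cong (λ s → g n x - g n x - s) S-closed ⟩
        g n x - g n x - 0ℚ     ≡⟨ solve 2 (λ a b → a :- a :- con 0ℚ := b :- b :- con 0ℚ) refl (g n x) (g 0 x) ⟩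
        Φ 0 x                  ≡⟨ cong (λ k → Φ k x) (sym (n%n≡0 n)) ⟩
        Φ (n % n) x            ∎

      off : Fin n → ℕ
      off = offset i

      φ : Fin (n ℕ.* m) → ℚ
      φ = glue (Φ ∘ off)

      φ-petal : ∀ j w → φ (petal j w) ≡ Φ (off j) w
      φ-petal = glue-petal (Φ ∘ off) λ j → begin
        Φ (off j) y              ≡⟨ Φ-step (off j) ⟩
        Φ (suc (off j)) x        ≡⟨ Φ-mod (offset<n i j) ⟩
        Φ (suc (off j) % n) x    ≡⟨ cong (λ k → Φ k x) (sym (offset-step i j)) ⟩
        Φ (off (rotate j 1)) x   ∎

      φ-rotate : ∀ {k} → k ℕ.< n → ∀ w → φ (petal (rotate i k) w) ≡ Φ k w
      φ-rotate {k} k<n w = trans (φ-petal (rotate i k) w) (cong (λ k → Φ k w) (offset-rotate-< i k<n))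

      current : ℕ → Fin (suc m) → ℚ
      current k w = δ (source k) (sink k) w + t * δ x y w

      laplacian-Φ : ∀ k → L ▹ Φ k ≗ current k
      laplacian-Φ k w = begin
        (L ▹ Φ k) w
          ≡⟨ •-congʳ (L w) (λ w′ → solve 3 (λ a b s → a :- b :- s := a :+ (:- (b :+ s)) :* con 1ℚ) refl (g k w′) (g k x) (S k)) ⟩
        L w • (λ w′ → g k w′ + (- (g k x + S k)) * 1ℚ)
          ≡⟨ •-linʳ (L w) (g k) (const 1ℚ) (- (g k x + S k)) ⟩
        L w • g k + (- (g k x + S k)) * (L ▹ const 1ℚ) w
          ≡⟨ cong₂ (λ z o → z + (- (g k x + S k)) * o) (•-linʳ (L w) (q k) h t) (laplacian-constant G (const 1ℚ) (λ _ _ → refl) w) ⟩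
        (L ▹ q k) w + t * (L ▹ h) w + (- (g k x + S k)) * 0ℚ
          ≡⟨ cong₂ (λ z o → z + t * o + (- (g k x + S k)) * 0ℚ) (laplacian-potential G connected (source k) (sink k) w) (laplacian-potential G connected x y w) ⟩
        current k w + (- (g k x + S k)) * 0ℚ
          ≡⟨ solve 2 (λ a b → a :+ b :* con 0ℚ := a) refl (current k w) (- (g k x + S k)) ⟩
        current k w ∎

      -- `E k` is the indicator of the vertex `a` seen from petal `k`. Paired with it, the route
      -- currents telescope to the two ends, and the circulation telescopes to `E 0 x - E n x`,
      -- which is zero after a full turn.
      laplacian-φ : laplacian flower ▹ φ ≗ δ (petal (rotate i 0) u) (petal (rotate i l) v)
      laplacian-φ a = begin
        (laplacian flower ▹ φ) a
          ≡⟨ laplacian-flower φ a ⟩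
        ∑[ j < n ] (e j • (L ▹ (φ ∘ petal j)))
          ≡⟨ sum-cong-≗ (λ j → •-congʳ (e j) λ w → trans (•-congʳ (L w) (φ-petal j)) (laplacian-Φ (off j) w)) ⟩
        ∑[ j < n ] (e j • current (off j))
          ≡⟨ sum-rotate i (λ j → e j • current (off j)) ⟩
        ∑[ k < n ] (E (toℕ k) • current (off (rotate i (toℕ k))))
          ≡⟨ sum-cong-≗ {n} (λ k → trans (cong (λ o → E (toℕ k) • current o) (offset-rotate-< i (Fin.toℕ<n k))) (E-current (toℕ k))) ⟩
        ∑[ k < n ] ((E (toℕ k) (source (toℕ k)) - E (toℕ k) (sink (toℕ k))) + t * (E (toℕ k) x - E (suc (toℕ k)) x))
          ≡⟨ ∑-distrib-+ {n} (λ k → E (toℕ k) (source (toℕ k)) - E (toℕ k) (sink (toℕ k))) (λ k → t * (E (toℕ k) x - E (suc (toℕ k)) x)) ⟩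
        ∑[ k < n ] (E (toℕ k) (source (toℕ k)) - E (toℕ k) (sink (toℕ k))) + ∑[ k < n ] (t * (E (toℕ k) x - E (suc (toℕ k)) x))
          ≡⟨ cong₂ _+_ (telescope E E-step) (trans (sym (*-distribˡ-sum {n} t (λ k → E (toℕ k) x - E (suc (toℕ k)) x)))
               (cong (t *_) (trans (sum-telescope (λ k → E k x) n) (cong (λ z → E 0 x - z) E-closed)))) ⟩
        (E 0 u - E l v) + t * (E 0 x - E 0 x)
          ≡⟨ solve 3 (λ z t w → z :+ t :* (w :- w) := z) refl (E 0 u - E l v) t (E 0 x) ⟩
        E 0 u - E l v ∎
        where
        e : Fin n → Fin (suc m) → ℚ
        e j w = unit (petal j w) a
        E : ℕ → Fin (suc m) → ℚ
        E k = e (rotate i k)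
        E-step : ∀ k → E k y ≡ E (suc k) x
        E-step k = cong (λ b → unit b a) (trans (petal-y (rotate i k)) (cong (λ j → petal j x)
          (trans (rotate-+ i k 1) (cong (rotate i) (ℕ.+-comm k 1)))))
        E-closed : E n x ≡ E 0 x
        E-closed = cong (λ j → e j x) (trans (rotate-n i) (sym (rotate-0 i)))
        E-current : ∀ k → E k • current k ≡ (E k (source k) - E k (sink k)) + t * (E k x - E (suc k) x)
        E-current k = begin
          E k • current k
            ≡⟨ •-linʳ (E k) (δ (source k) (sink k)) (δ x y) t ⟩
          E k • δ (source k) (sink k) + t * (E k • δ x y)
            ≡⟨ cong₂ (λ z w → z + t * w) (•-δ (E k) (source k) (sink k)) (•-δ (E k) x y) ⟩
          (E k (source k) - E k (sink k)) + t * (E k x - E k y)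
            ≡⟨ cong (λ z → (E k (source k) - E k (sink k)) + t * (E k x - z)) (E-step k) ⟩
          (E k (source k) - E k (sink k)) + t * (E k x - E (suc k) x) ∎

    -- `telescope` splits the potential difference of the ends into differences between the
    -- terminals in each petal. There `q k` contributes a resistance of `G`, and the circulation a
    -- drop of `t * h`; these drops sum to `t * D` by `sum-h`.
    resistance-route : resistance flower (petal i u) (petal (rotate i l) v) ≡
                       total (resistance G) + t * (h u - h v + fromℕ l * R)
    resistance-route = begin
      resistance flower (petal i u) (petal (rotate i l) v)
        ≡⟨ cong (λ j → resistance flower (petal j u) (petal (rotate i l) v)) (sym (rotate-0 i)) ⟩
      resistance flower (petal (rotate i 0) u) (petal (rotate i l) v)
        ≡⟨ resistance-from-potential flower φ laplacian-φ ⟩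
      φ (petal (rotate i 0) u) - φ (petal (rotate i l) v)
        ≡⟨ cong₂ _-_ (φ-rotate (ℕ.>-nonZero⁻¹ n) u) (φ-rotate l<n v) ⟩
      Φ 0 u - Φ l v
        ≡⟨ sym (telescope Φ Φ-step) ⟩
      ∑[ k < n ] (Φ (toℕ k) (source (toℕ k)) - Φ (toℕ k) (sink (toℕ k)))
        ≡⟨ sum-cong-≗ {n} (λ k → along (toℕ k)) ⟩
      ∑[ k < n ] (resistance G (source (toℕ k)) (sink (toℕ k)) + t * (h (source (toℕ k)) - h (sink (toℕ k))))
        ≡⟨ ∑-distrib-+ {n} (λ k → resistance G (source (toℕ k)) (sink (toℕ k))) (λ k → t * (h (source (toℕ k)) - h (sink (toℕ k)))) ⟩
      total (resistance G) + ∑[ k < n ] (t * (h (source (toℕ k)) - h (sink (toℕ k))))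
        ≡⟨ cong (total (resistance G) +_) (trans (sym (*-distribˡ-sum {n} t (λ k → h (source (toℕ k)) - h (sink (toℕ k))))) (cong (t *_) sum-h)) ⟩
      total (resistance G) + t * D ∎
      where
      along : ∀ k → Φ k (source k) - Φ k (sink k) ≡ resistance G (source k) (sink k) + t * (h (source k) - h (sink k))
      along k = begin
        Φ k (source k) - Φ k (sink k)
          ≡⟨ solve 7 (λ a b t c d p s → ((a :+ t :* c) :- p :- s) :- ((b :+ t :* d) :- p :- s) := (a :- b) :+ t :* (c :- d)) refl
               (q k (source k)) (q k (sink k)) t (h (source k)) (h (sink k)) (g k x) (S k) ⟩
        (q k (source k) - q k (sink k)) + t * (h (source k) - h (sink k))
          ≡⟨ cong (_+ t * (h (source k) - h (sink k))) (sym (resistance-potential G (source k) (sink k))) ⟩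
        resistance G (source k) (sink k) + t * (h (source k) - h (sink k)) ∎

  -- W = −2D turns tD, with t = −D/(nR), into −W²/(4nR).
  resistance-route-÷ : ∀ {u v l} (ρ : Route n x y u v l) i W →
    fromℕ 2 * (h u - h v + fromℕ l * R) ≡ - W →
    (4nR≢0 : NonZero (fromℕ (4 ℕ.* n) * R)) →
    resistance flower (petal i u) (petal (rotate i l) v) ≡
      Route.total ρ (resistance G) - _÷_ (W ²) (fromℕ (4 ℕ.* n) * R) {{4nR≢0}}
  resistance-route-÷ {u} {v} {l} ρ i W 2D≡-W 4nR≢0 = begin
    resistance flower (petal i u) (petal (rotate i l) v)
      ≡⟨ resistance-route ρ t closed i ⟩
    Route.total ρ (resistance G) + t * D
      ≡⟨ cong (Route.total ρ (resistance G) +_) tD ⟩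
    Route.total ρ (resistance G) - W ² * 1/ Z ∎
    where
    instance _ = 4nR≢0
    Z D t : ℚ
    Z = fromℕ (4 ℕ.* n) * R
    D = h u - h v + fromℕ l * R
    -- This is `−D/(nR)` written over the denominator `Z` of the final formula; `closed` is
    -- accordingly checked after multiplication by 4.
    t = - (fromℕ 4 * D) * 1/ Z
    closed : fromℕ n * (t * R) + D ≡ 0ℚ
    closed = *-cancel-0 (fromℕ 4) (fromℕ≢0 4) (begin
      fromℕ 4 * (fromℕ n * (t * R) + D)
        ≡⟨ solve 5 (λ f n t r d → f :* (n :* (t :* r) :+ d) := t :* ((f :* n) :* r) :+ f :* d) refl (fromℕ 4) (fromℕ n) t R D ⟩
      t * (fromℕ 4 * fromℕ n * R) + fromℕ 4 * D
        ≡⟨ cong (λ z → t * (z * R) + fromℕ 4 * D) (sym (fromℕ-* 4 n)) ⟩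
      - (fromℕ 4 * D) * 1/ Z * Z + fromℕ 4 * D
        ≡⟨ cong (_+ fromℕ 4 * D) (trans (*-assoc (- (fromℕ 4 * D)) (1/ Z) Z) (cong (- (fromℕ 4 * D) *_) (*-inverseˡ Z))) ⟩
      - (fromℕ 4 * D) * 1ℚ + fromℕ 4 * D
        ≡⟨ solve 1 (λ a → (:- a) :* con 1ℚ :+ a := con 0ℚ) refl (fromℕ 4 * D) ⟩
      0ℚ ∎)
    tD : t * D ≡ - (W ² * 1/ Z)
    tD = begin
      - (fromℕ 4 * D) * 1/ Z * D
        ≡⟨ solve 2 (λ d z → (:- (con (fromℕ 4) :* d)) :* z :* d := :- (((con (fromℕ 2) :* d) :* (con (fromℕ 2) :* d)) :* z)) refl D (1/ Z) ⟩
      - ((fromℕ 2 * D) ² * 1/ Z)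
        ≡⟨ cong (λ z → - (z ² * 1/ Z)) 2D≡-W ⟩
      - ((- W) ² * 1/ Z)
        ≡⟨ solve 2 (λ w z → :- (((:- w) :* (:- w)) :* z) := :- ((w :* w) :* z)) refl W (1/ Z) ⟩
      - (W ² * 1/ Z) ∎

-- Routes inside one petal and across several.

-- Petals that the route does not visit get equal terminals, i.e. zero current.
local : ∀ n .{{_ : ℕ.NonZero n}} {m} {x y : Fin m} (u v : Fin m) →
        Σ[ ρ ∈ Route n x y u v 0 ] (∀ f → f x x ≡ 0ℚ → Route.total ρ f ≡ f u v)
local (suc n) {x = x} u v = record
  { source    = λ { zero → u ; (suc _) → x }
  ; sink      = λ { zero → v ; (suc _) → x }
  ; l<n       = ℕ.z<s
  ; telescope = λ F _ → trans (cong (F 0 u - F 0 v +_) (sum-≡0 {n} λ k → +-inverseʳ (F (suc (toℕ k)) x)))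
                              (+-identityʳ (F 0 u - F 0 v))
  } , λ f fxx≡0 → trans (cong (f u v +_) (sum-≡0 {n} λ _ → fxx≡0)) (+-identityʳ (f u v))

module _ {m} (x y v : Fin m) where

  -- Past the first petal a route always enters at `x`: it crosses `e` petals to `y`, stops at `v`
  -- in the next, and stays at `x` afterwards.
  tailSink : ℕ → ℕ → Fin m
  tailSink zero    zero    = v
  tailSink zero    (suc _) = x
  tailSink (suc e) zero    = y
  tailSink (suc e) (suc k) = tailSink e k

  -- The petals are counted as `e` crossed, one containing `v`, and `s` unvisited, so that induction
  -- on `e` follows the route.
  tail-telescope : ∀ e s (F : ℕ → Fin m → ℚ) → (∀ k → F k y ≡ F (suc k) x) →
    ∑[ k < suc (e ℕ.+ s) ] (F (toℕ k) x - F (toℕ k) (tailSink e (toℕ k))) ≡ F 0 x - F e v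
  tail-telescope zero    s F step = trans
    (cong (F 0 x - F 0 v +_) (sum-≡0 {s} λ k → +-inverseʳ (F (suc (toℕ k)) x)))
    (+-identityʳ (F 0 x - F 0 v))
  tail-telescope (suc e) s F step = begin
    F 0 x - F 0 y + ∑[ k < suc (e ℕ.+ s) ] (F (suc (toℕ k)) x - F (suc (toℕ k)) (tailSink e (toℕ k)))
      ≡⟨ cong₂ (λ z w → F 0 x - z + w) (step 0) (tail-telescope e s (F ∘ suc) (step ∘ suc)) ⟩
    F 0 x - F 1 x + (F 1 x - F (suc e) v)
      ≡⟨ solve 3 (λ a b c → a :- b :+ (b :- c) := a :- c) refl (F 0 x) (F 1 x) (F (suc e) v) ⟩
    F 0 x - F (suc e) v ∎

  tail-total : ∀ e s (f : Fin m → Fin m → ℚ) → f x x ≡ 0ℚ →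
    ∑[ k < suc (e ℕ.+ s) ] f x (tailSink e (toℕ k)) ≡ fromℕ e * f x y + f x v
  tail-total zero    s f fxx≡0 = trans (cong (f x v +_) (sum-≡0 {s} λ _ → fxx≡0))
    (solve 2 (λ a b → b :+ con 0ℚ := con 0ℚ :* a :+ b) refl (f x y) (f x v))
  tail-total (suc e) s f fxx≡0 = begin
    f x y + ∑[ k < suc (e ℕ.+ s) ] f x (tailSink e (toℕ k))
      ≡⟨ cong (f x y +_) (tail-total e s f fxx≡0) ⟩
    f x y + (fromℕ e * f x y + f x v)
      ≡⟨ solve 3 (λ k a b → a :+ (k :* a :+ b) := (con 1ℚ :+ k) :* a :+ b) refl (fromℕ e) (f x y) (f x v) ⟩
    (1ℚ + fromℕ e) * f x y + f x v
      ≡⟨ cong (λ z → z * f x y + f x v) (sym (fromℕ-suc e)) ⟩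
    fromℕ (suc e) * f x y + f x v ∎

spanning : ∀ {n m} {x y : Fin m} e → suc (suc e) ℕ.≤ n → (u v : Fin m) →
           Σ[ ρ ∈ Route n x y u v (suc e) ]
             (∀ f → f x x ≡ 0ℚ → Route.total ρ f ≡ f u y + (fromℕ e * f x y + f x v))
-- Naming the surplus `s` of unvisited petals turns `n` into `suc (suc (e ℕ.+ s))`, and the sums
-- over petals unfold.
spanning {n} {x = x} {y} e 2+e≤n u v with ℕ.m≤n⇒∃[o]m+o≡n 2+e≤n
... | s , refl = record
  { source    = λ { zero → u ; (suc _) → x }
  ; sink      = λ { zero → y ; (suc k) → tailSink x y v e k }
  ; l<n       = 2+e≤n
  ; telescope = λ F step → begin
      F 0 u - F 0 y + ∑[ k < suc (e ℕ.+ s) ] (F (suc (toℕ k)) x - F (suc (toℕ k)) (tailSink x y v e (toℕ k)))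
        ≡⟨ cong₂ (λ z w → F 0 u - z + w) (step 0) (tail-telescope x y v e s (F ∘ suc) (step ∘ suc)) ⟩
      F 0 u - F 1 x + (F 1 x - F (suc e) v)
        ≡⟨ solve 3 (λ a b c → a :- b :+ (b :- c) := a :- c) refl (F 0 u) (F 1 x) (F (suc e) v) ⟩
      F 0 u - F (suc e) v ∎
  } , λ f fxx≡0 → cong (f u y +_) (tail-total x y v e s f fxx≡0)

-- The resistance formulas from the two kinds of route.

theorem3p2 :
  ∀ {m} (G : Graph (suc m)) → Connected G →
  ∀ {x y : Fin (suc m)} (x≢y : x ≢ y) (n : ℕ) (3≤n : 3 ℕ.≤ n) →
  let open Flower G x≢y n 3≤n
      r  = resistance G
      rF = resistance flower
      4nr = fromℕ (4 ℕ.* n) * r x y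
  in
  -- the denominator is nonzero, so the fractions below make sense
  Σ[ 4nr≢0 ∈ NonZero 4nr ]
    ( (∀ (i : Fin n) (d : ℕ) → 2 ℕ.≤ d → d ℕ.≤ n → ∀ (u v : Fin (suc m)) →
         rF (petal i u) (petal (rotate i (d ∸ 1)) v) ≡
           r u y + r v x + (fromℕ d - fromℕ 2) * r x y
           - _÷_ ((r u x + r v y - r u y - r v x
                    - fromℕ 2 * (fromℕ d - fromℕ 1) * r x y) ²)
                 4nr {{4nr≢0}})
    × (∀ (i : Fin n) (u v : Fin (suc m)) →
         rF (petal i u) (petal i v) ≡
           r u v - _÷_ ((r u x + r v y - r u y - r v x) ²) 4nr {{4nr≢0}})
    )
theorem3p2 {m} G connected {x} {y} x≢y n 3≤n = 4nr≢0 , different , same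
  where
  open Flower G x≢y n 3≤n
  open Petals G x≢y n 3≤n
  r : Fin (suc m) → Fin (suc m) → ℚ
  r = resistance G
  h : Fin (suc m) → ℚ
  h = potential G x y
  instance
    n≢0 : ℕ.NonZero n
    n≢0 = ℕ.>-nonZero (ℕ.≤-trans (ℕ.s≤s ℕ.z≤n) 3≤n)
  4nr≢0 : NonZero (fromℕ (4 ℕ.* n) * r x y)
  4nr≢0 = ≢-nonZero (*-≢0 (fromℕ≢0 (4 ℕ.* n) {{ℕ.m*n≢0 4 n}}) (resistance-≢0 G connected x≢y))

  different : ∀ (i : Fin n) (d : ℕ) → 2 ℕ.≤ d → d ℕ.≤ n → ∀ (u v : Fin (suc m)) →
    resistance flower (petal i u) (petal (rotate i (d ∸ 1)) v) ≡
    r u y + r v x + (fromℕ d - fromℕ 2) * r x y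
    - _÷_ ((r u x + r v y - r u y - r v x - fromℕ 2 * (fromℕ d - fromℕ 1) * r x y) ²)
      (fromℕ (4 ℕ.* n) * r x y) {{4nr≢0}}
  -- With `d = e + 2`, the route leaves the first petal at `y`, crosses `e` petals and enters the
  -- last at `x`; `d ∸ 1` reduces to `suc e`.
  different i (suc (suc e)) (ℕ.s≤s (ℕ.s≤s _)) d≤n u v = begin
    resistance flower (petal i u) (petal (rotate i (suc e)) v)
      ≡⟨ resistance-route-÷ G connected x≢y n 3≤n ρ i W 2D≡-W 4nr≢0 ⟩
    Route.total ρ r - _÷_ (W ²) (fromℕ (4 ℕ.* n) * r x y) {{4nr≢0}}
      ≡⟨ cong (_- _÷_ (W ²) (fromℕ (4 ℕ.* n) * r x y) {{4nr≢0}}) (begin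
           Route.total ρ r
             ≡⟨ proj₂ route r (resistance-refl G x) ⟩
           r u y + (fromℕ e * r x y + r x v)
             ≡⟨ cong (λ z → r u y + (fromℕ e * r x y + z)) (resistance-sym G x v) ⟩
           r u y + (fromℕ e * r x y + r v x)
             -- `fromℕ` of a variable is an atom to the solver, so `d` appears as `1 + (1 + e)` here
             -- and is restored by `fromℕ-d`.
             ≡⟨ solve 4 (λ a b k c → a :+ (k :* c :+ b) := a :+ b :+ ((con 1ℚ :+ (con 1ℚ :+ k)) :- con (fromℕ 2)) :* c) refl
                  (r u y) (r v x) (fromℕ e) (r x y) ⟩
           r u y + r v x + ((1ℚ + (1ℚ + fromℕ e)) - fromℕ 2) * r x y
             ≡⟨ cong (λ d → r u y + r v x + (d - fromℕ 2) * r x y) (sym fromℕ-d) ⟩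
           r u y + r v x + (fromℕ (suc (suc e)) - fromℕ 2) * r x y ∎) ⟩
    r u y + r v x + (fromℕ (suc (suc e)) - fromℕ 2) * r x y - _÷_ (W ²) (fromℕ (4 ℕ.* n) * r x y) {{4nr≢0}} ∎
    where
    route : Σ[ ρ ∈ Route n x y u v (suc e) ] (∀ f → f x x ≡ 0ℚ → Route.total ρ f ≡ f u y + (fromℕ e * f x y + f x v))
    route = spanning e d≤n u v
    ρ : Route n x y u v (suc e)
    ρ = proj₁ route
    W : ℚ
    W = r u x + r v y - r u y - r v x - fromℕ 2 * (fromℕ (suc (suc e)) - fromℕ 1) * r x y
    fromℕ-d : fromℕ (suc (suc e)) ≡ 1ℚ + (1ℚ + fromℕ e)
    fromℕ-d = trans (fromℕ-suc (suc e)) (cong (1ℚ +_) (fromℕ-suc e))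
    -- `polarisation` expresses `h u - h v` through resistances; the remaining `suc e = d − 1`
    -- multiples of `r x y` supply the last term of `W`.
    2D≡-W : fromℕ 2 * (h u - h v + fromℕ (suc e) * r x y) ≡ - W
    2D≡-W = begin
      fromℕ 2 * (h u - h v + fromℕ (suc e) * r x y)
        ≡⟨ *-distribˡ-+ (fromℕ 2) (h u - h v) (fromℕ (suc e) * r x y) ⟩
      fromℕ 2 * (h u - h v) + fromℕ 2 * (fromℕ (suc e) * r x y)
        ≡⟨ cong (_+ fromℕ 2 * (fromℕ (suc e) * r x y)) (polarisation G connected x y u v) ⟩
      r u y + r v x - r u x - r v y + fromℕ 2 * (fromℕ (suc e) * r x y)
        ≡⟨ solve 6 (λ a b c d k z → a :+ b :- c :- d :+ con (fromℕ 2) :* (k :* z) :=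
             :- (c :+ d :- a :- b :- con (fromℕ 2) :* ((con 1ℚ :+ k) :- con (fromℕ 1)) :* z)) refl
             (r u y) (r v x) (r u x) (r v y) (fromℕ (suc e)) (r x y) ⟩
      - (r u x + r v y - r u y - r v x - fromℕ 2 * ((1ℚ + fromℕ (suc e)) - fromℕ 1) * r x y)
        ≡⟨ cong (λ d → - (r u x + r v y - r u y - r v x - fromℕ 2 * (d - fromℕ 1) * r x y)) (sym (fromℕ-suc (suc e))) ⟩
      - W ∎

  same : ∀ (i : Fin n) (u v : Fin (suc m)) →
    resistance flower (petal i u) (petal i v) ≡
    r u v - _÷_ ((r u x + r v y - r u y - r v x) ²) (fromℕ (4 ℕ.* n) * r x y) {{4nr≢0}}
  same i u v = begin
    resistance flower (petal i u) (petal i v)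
      ≡⟨ cong (λ j → resistance flower (petal i u) (petal j v)) (sym (rotate-0 i)) ⟩
    resistance flower (petal i u) (petal (rotate i 0) v)
      ≡⟨ resistance-route-÷ G connected x≢y n 3≤n ρ i W 2D≡-W 4nr≢0 ⟩
    Route.total ρ r - _÷_ (W ²) (fromℕ (4 ℕ.* n) * r x y) {{4nr≢0}}
      ≡⟨ cong (_- _÷_ (W ²) (fromℕ (4 ℕ.* n) * r x y) {{4nr≢0}}) (proj₂ route r (resistance-refl G x)) ⟩
    r u v - _÷_ (W ²) (fromℕ (4 ℕ.* n) * r x y) {{4nr≢0}} ∎
    where
    route : Σ[ ρ ∈ Route n x y u v 0 ] (∀ f → f x x ≡ 0ℚ → Route.total ρ f ≡ f u v)
    route = local n u v
    ρ : Route n x y u v 0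
    ρ = proj₁ route
    W : ℚ
    W = r u x + r v y - r u y - r v x
    2D≡-W : fromℕ 2 * (h u - h v + fromℕ 0 * r x y) ≡ - W
    2D≡-W = begin
      fromℕ 2 * (h u - h v + 0ℚ * r x y)
        ≡⟨ solve 2 (λ a z → con (fromℕ 2) :* (a :+ con 0ℚ :* z) := con (fromℕ 2) :* a) refl (h u - h v) (r x y) ⟩
      fromℕ 2 * (h u - h v)
        ≡⟨ polarisation G connected x y u v ⟩
      r u y + r v x - r u x - r v y
        ≡⟨ solve 4 (λ a b c d → a :+ b :- c :- d := :- (c :+ d :- a :- b)) refl (r u y) (r v x) (r u x) (r v y) ⟩
      - W ∎
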